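{- Let $f:[0,\infty)\to[0,\infty)$ be a continuous and non-decreasing function, and let $(x_N)_{N\in\mathbb{N}}$ be a sequence in $[0,1)$. Suppose there exist some $k\in\mathbb{N}$ and infinitely many $N\in\mathbb{N}$ such that the finite point set $x_1,\ldots,x_N$ has at most $k$ distinct gap lengths. Then $(x_N)_{N\in\mathbb{N}}$ does not have $f$-pair correlations; that is, it is not the case that \[ \lim_{N\to\infty}\frac{1}{N}\,\#\left\{1\le i\neq j\le N \;\middle|\; \|x_i-x_j\|\le \frac{s}{N}\right\} = f(s) \] holds for all $s\ge 0$.
   Context: Points of $[0,1)$ are regarded as points of the torus $\mathbb{T}^1=[0,1]/\sim$ (with $0$ and $1$ identified). For $x\in\mathbb{R}$, $\|x\|=\min\{|x-z| : z\in\mathbb{Z}\}$ denotes the distance to the nearest integer. For $s\ge 0$ and $N\in\mathbb{N}$, set $R(s,N)=\#\{1\le i\neq j\le N : \|x_i-x_j\|\le s/N\}$ (counting ordered pairs of distinct indices). A sequence has $f$-pair correlations if $\lim_{N\to\infty}\frac1N R(s,N)=f(s)$ for all $s\ge0$. The gap lengths of a finite point set $x_1,\ldots,x_N$ in $\mathbb{T}^1$ are the distances between neighboring elements on the circle: if $y_1\le y_2\le\cdots\le y_N$ is the nondecreasing rearrangement of $x_1,\ldots,x_N$ (repeated points allowed, so a gap length may be $0$), the gap lengths are the values $\|y_{i+1}-y_i\|$ for $1\le i\le N$, where $y_{N+1}:=y_1$. -}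

module Defs where

open import Axiom.ExcludedMiddle using (ExcludedMiddle)
open import Data.Empty using (⊥-elim)
open import Data.Integer.Base as ℤ using (ℤ; +_; -[1+_])
import Data.Integer.Properties as ℤₚ
open import Data.List.Base using (List; map; _++_; length; filter; deduplicate; cartesianProduct; upTo; zipWith; take; drop)
import Data.List.Extrema as Extrema
open import Data.List.Membership.Propositional using (_∈_; lose)
open import Data.List.Membership.Propositional.Properties using (∈-map⁺; ∈-++⁺ˡ; ∈-++⁺ʳ; ∈-upTo⁺)
open import Data.List.Relation.Unary.Any using (Any)
import Data.List.Sort as Sort
open import Data.Nat.Base as ℕ using (ℕ; suc; NonZero)
open import Data.Nat.Coprimality using (1-coprimeTo)
import Data.Nat.Properties as ℕₚ
open import Data.Product.Base using (Σ; ∃-syntax; _×_; _,_; proj₁; proj₂; swap)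
open import Data.Rational.Base as ℚ using (ℚ; mkℚ; 0ℚ; 1ℚ; ½)
open import Data.Rational.Literals using (fromℤ)
import Data.Rational.Properties as ℚₚ
open import Data.Rational.Solver using (module +-*-Solver)
open import Data.Sum.Base using (_⊎_; inj₁; inj₂)
open import Level using (0ℓ)
open import Relation.Binary.Bundles using (DecTotalOrder)
open import Relation.Binary.Definitions using (Reflexive; Transitive; Total)
open import Relation.Binary.PropositionalEquality using (_≡_; _≢_; refl; sym; trans; cong; cong₂; subst; subst₂)
open import Relation.Unary using (Decidable)
open import Relation.Nullary using (Dec; ¬_; yes; no)

private

  p≤∣p∣ : ∀ p → p ℚ.≤ ℚ.∣ p ∣
  p≤∣p∣ p with ℚₚ.≤-total 0ℚ p
  ... | inj₁ 0≤p = ℚₚ.≤-reflexive (sym (ℚₚ.0≤p⇒∣p∣≡p 0≤p))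
  ... | inj₂ p≤0 = ℚₚ.≤-trans p≤0 (ℚₚ.0≤∣p∣ p)

  ∣p∣≤r : ∀ {p r} → p ℚ.≤ r → ℚ.- p ℚ.≤ r → ℚ.∣ p ∣ ℚ.≤ r
  ∣p∣≤r {p} p≤r -p≤r with ℚₚ.∣p∣≡p∨∣p∣≡-p p
  ... | inj₁ e = subst (ℚ._≤ _) (sym e) p≤r
  ... | inj₂ e = subst (ℚ._≤ _) (sym e) -p≤r

  ∣p-q∣≡∣q-p∣ : ∀ p q → ℚ.∣ p ℚ.- q ∣ ≡ ℚ.∣ q ℚ.- p ∣
  ∣p-q∣≡∣q-p∣ p q = trans (cong ℚ.∣_∣ flip) (ℚₚ.∣-p∣≡∣p∣ (q ℚ.- p))
    where
    open +-*-Solver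
    flip : p ℚ.- q ≡ ℚ.- (q ℚ.- p)
    flip = solve 2 (λ p q → p :- q := :- (q :- p)) refl p q

  p≤q+∣p-q∣ : ∀ p q → p ℚ.≤ q ℚ.+ ℚ.∣ p ℚ.- q ∣
  p≤q+∣p-q∣ p q = subst (ℚ._≤ q ℚ.+ ℚ.∣ p ℚ.- q ∣) eq (ℚₚ.+-monoʳ-≤ q (p≤∣p∣ (p ℚ.- q)))
    where
    open +-*-Solver
    eq : q ℚ.+ (p ℚ.- q) ≡ p
    eq = solve 2 (λ p q → q :+ (p :- q) := p) refl p q

  close⇒≤ : ∀ p q {ε} → ℚ.∣ p ℚ.- q ∣ ℚ.< ε → p ℚ.≤ q ℚ.+ ε
  close⇒≤ p q d = ℚₚ.≤-trans (p≤q+∣p-q∣ p q) (ℚₚ.+-monoʳ-≤ q (ℚₚ.<⇒≤ d))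

  p≤q+r⇒p-q≤r : ∀ {p q r} → p ℚ.≤ q ℚ.+ r → p ℚ.- q ℚ.≤ r
  p≤q+r⇒p-q≤r {p} {q} {r} h = subst (p ℚ.- q ℚ.≤_) eq (ℚₚ.+-monoˡ-≤ (ℚ.- q) h)
    where
    open +-*-Solver
    eq : q ℚ.+ r ℚ.- q ≡ r
    eq = solve 2 (λ q r → (q :+ r) :- q := r) refl q r

  ∣p∣≤∣q∣+∣p-q∣ : ∀ p q → ℚ.∣ p ∣ ℚ.≤ ℚ.∣ q ∣ ℚ.+ ℚ.∣ p ℚ.- q ∣
  ∣p∣≤∣q∣+∣p-q∣ p q = subst (λ t → ℚ.∣ t ∣ ℚ.≤ ℚ.∣ q ∣ ℚ.+ ℚ.∣ p ℚ.- q ∣) eq (ℚₚ.∣p+q∣≤∣p∣+∣q∣ q (p ℚ.- q))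
    where
    open +-*-Solver
    eq : q ℚ.+ (p ℚ.- q) ≡ p
    eq = solve 2 (λ p q → q :+ (p :- q) := p) refl p q

  ∣∣-lipschitz : ∀ p q → ℚ.∣ ℚ.∣ p ∣ ℚ.- ℚ.∣ q ∣ ∣ ℚ.≤ ℚ.∣ p ℚ.- q ∣
  ∣∣-lipschitz p q = ∣p∣≤r
    (p≤q+r⇒p-q≤r (∣p∣≤∣q∣+∣p-q∣ p q))
    (subst₂ ℚ._≤_ eq (∣p-q∣≡∣q-p∣ q p) (p≤q+r⇒p-q≤r (∣p∣≤∣q∣+∣p-q∣ q p)))
    where
    open +-*-Solver
    eq : ℚ.∣ q ∣ ℚ.- ℚ.∣ p ∣ ≡ ℚ.- (ℚ.∣ p ∣ ℚ.- ℚ.∣ q ∣)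
    eq = solve 2 (λ a b → b :- a := :- (a :- b)) refl ℚ.∣ p ∣ ℚ.∣ q ∣

  *-lipschitz : ∀ r → 0ℚ ℚ.≤ r → r ℚ.≤ 1ℚ →
                ∀ p q → ℚ.∣ p ℚ.* r ℚ.- q ℚ.* r ∣ ℚ.≤ ℚ.∣ p ℚ.- q ∣
  *-lipschitz r 0≤r r≤1 p q = begin
    ℚ.∣ p ℚ.* r ℚ.- q ℚ.* r ∣   ≡⟨ cong ℚ.∣_∣ eq ⟩
    ℚ.∣ (p ℚ.- q) ℚ.* r ∣       ≡⟨ ℚₚ.∣p*q∣≡∣p∣*∣q∣ (p ℚ.- q) r ⟩
    ℚ.∣ p ℚ.- q ∣ ℚ.* ℚ.∣ r ∣   ≡⟨ cong (ℚ.∣ p ℚ.- q ∣ ℚ.*_) (ℚₚ.0≤p⇒∣p∣≡p 0≤r) ⟩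
    ℚ.∣ p ℚ.- q ∣ ℚ.* r         ≤⟨ ℚₚ.*-monoˡ-≤-nonNeg ℚ.∣ p ℚ.- q ∣ {{ℚₚ.∣-∣-nonNeg (p ℚ.- q)}} r≤1 ⟩
    ℚ.∣ p ℚ.- q ∣ ℚ.* 1ℚ        ≡⟨ ℚₚ.*-identityʳ _ ⟩
    ℚ.∣ p ℚ.- q ∣               ∎
    where
    open ℚₚ.≤-Reasoning
    eq : p ℚ.* r ℚ.- q ℚ.* r ≡ (p ℚ.- q) ℚ.* r
    eq = solve 3 (λ p q r → p :* r :- q :* r := (p :- q) :* r) refl p q r
      where open +-*-Solver

  ⅕ : ℚ
  ⅕ = (+ 1) ℚ./ 5

  p≤p+ε : ∀ p {ε} → 0ℚ ℚ.< ε → p ℚ.≤ p ℚ.+ ε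
  p≤p+ε p {ε} 0<ε = subst (ℚ._≤ p ℚ.+ ε) (ℚₚ.+-identityʳ p) (ℚₚ.+-monoʳ-≤ p (ℚₚ.<⇒≤ 0<ε))

  half : ∀ {ε} → 0ℚ ℚ.< ε → 0ℚ ℚ.< ε ℚ.* ½
  half 0<ε = ℚₚ.*-monoˡ-<-pos ½ 0<ε

  half+half : ∀ ε → ε ℚ.* ½ ℚ.+ ε ℚ.* ½ ≡ ε
  half+half = solve 1 (λ e → e :* con ½ :+ e :* con ½ := e) refl
    where open +-*-Solver

  +5×1/5 : ∀ ε → ε ℚ.* ⅕ ℚ.+ ε ℚ.* ⅕ ℚ.+ ε ℚ.* ⅕ ℚ.+ ε ℚ.* ⅕ ℚ.+ ε ℚ.* ⅕ ≡ ε
  +5×1/5 = solve 1 (λ e → let d = e :* con ⅕ in d :+ d :+ d :+ d :+ d := e) refl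
    where open +-*-Solver

  fromℤ-mono : ∀ {i j} → i ℤ.≤ j → fromℤ i ℚ.≤ fromℤ j
  fromℤ-mono i≤j = ℚ.*≤* (ℤₚ.*-monoʳ-≤-nonNeg (+ 1) i≤j)

  ∣fromℤ∣ : ∀ z → ℚ.∣ fromℤ z ∣ ≡ fromℤ (+ ℤ.∣ z ∣)
  ∣fromℤ∣ (+ n)    = refl
  ∣fromℤ∣ -[1+ n ] = refl

  1/n-bounds : ∀ n .{{_ : NonZero n}} → 0ℚ ℚ.≤ (+ 1) ℚ./ n × (+ 1) ℚ./ n ℚ.≤ 1ℚ
  1/n-bounds (suc n) = subst (λ t → 0ℚ ℚ.≤ t × t ℚ.≤ 1ℚ) (sym (ℚₚ.↥p/↧p≡p 1/1+n))
    ( ℚₚ.nonNegative⁻¹ 1/1+n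
    , ℚ.*≤* (ℤ.+≤+ (ℕ.s≤s ℕ.z≤n)) )
    where
    1/1+n : ℚ
    1/1+n = mkℚ (+ 1) n (1-coprimeTo (suc n))

  archimedean : ∀ q → ∃[ b ] q ℚ.≤ fromℤ (+ b)
  archimedean (mkℚ i d-1 _) = ℤ.∣ i ∣ , ℚ.*≤* (begin
    i ℤ.* + 1                   ≡⟨ ℤₚ.*-identityʳ i ⟩
    i                           ≤⟨ i≤∣i∣ i ⟩
    + ℤ.∣ i ∣                   ≤⟨ ℤ.+≤+ (ℕₚ.m≤m*n ℤ.∣ i ∣ (suc d-1)) ⟩
    + (ℤ.∣ i ∣ ℕ.* suc d-1)     ≡⟨ ℤₚ.pos-* ℤ.∣ i ∣ (suc d-1) ⟩
    + ℤ.∣ i ∣ ℤ.* + suc d-1     ∎)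
    where
    open ℤₚ.≤-Reasoning
    i≤∣i∣ : ∀ i → i ℤ.≤ + ℤ.∣ i ∣
    i≤∣i∣ (+ n)    = ℤₚ.≤-refl
    i≤∣i∣ -[1+ n ] = ℤ.-≤+

-- Real numbers are Cauchy sequences of rationals, without a quotient:
-- equality of reals is _≃_.

record ℝ : Set where
  constructor mkℝ
  field
    seq    : ℕ → ℚ
    cauchy : ∀ {ε} → 0ℚ ℚ.< ε →
             ∃[ M ] ∀ {m n} → M ℕ.≤ m → M ℕ.≤ n → ℚ.∣ seq m ℚ.- seq n ∣ ℚ.< ε

open ℝ public

infix 4 _≤_ _<_ _≃_

_≤_ : ℝ → ℝ → Set
x ≤ y = ∀ {ε} → 0ℚ ℚ.< ε → ∃[ M ] ∀ {n} → M ℕ.≤ n → seq x n ℚ.≤ seq y n ℚ.+ ε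

_<_ : ℝ → ℝ → Set
x < y = ¬ (y ≤ x)

_≃_ : ℝ → ℝ → Set
x ≃ y = x ≤ y × y ≤ x

private

  lipschitz : (g : ℚ → ℚ) → (∀ p q → ℚ.∣ g p ℚ.- g q ∣ ℚ.≤ ℚ.∣ p ℚ.- q ∣) → ℝ → ℝ
  lipschitz g g-lip x .seq n = g (seq x n)
  lipschitz g g-lip x .cauchy 0<ε with cauchy x 0<ε
  ... | M , close = M , λ M≤m M≤n → ℚₚ.≤-<-trans (g-lip _ _) (close M≤m M≤n)

fromℚ : ℚ → ℝ
fromℚ q .seq _ = q
fromℚ q .cauchy 0<ε =
  0 , λ _ _ → subst (ℚ._< _) (sym (cong ℚ.∣_∣ (ℚₚ.+-inverseʳ q))) 0<ε

fromInt : ℤ → ℝ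
fromInt z = fromℚ (fromℤ z)

fromNat : ℕ → ℝ
fromNat n = fromInt (+ n)

0ℝ 1ℝ : ℝ
0ℝ = fromNat 0
1ℝ = fromNat 1

infixl 6 _-_
infixl 7 _÷_

_-_ : ℝ → ℝ → ℝ
(x - y) .seq n = seq x n ℚ.- seq y n
(x - y) .cauchy {ε} 0<ε with cauchy x (half 0<ε) | cauchy y (half 0<ε)
... | M₁ , close₁ | M₂ , close₂ = M₁ ℕ.⊔ M₂ , λ {m} {n} M≤m M≤n →
  let a = seq x m
      b = seq x n
      c = seq y m
      d = seq y n
  in begin-strict
    ℚ.∣ (a ℚ.- c) ℚ.- (b ℚ.- d) ∣       ≡⟨ cong ℚ.∣_∣ (rearrange a b c d) ⟩
    ℚ.∣ (a ℚ.- b) ℚ.- (c ℚ.- d) ∣       ≤⟨ ℚₚ.∣p-q∣≤∣p∣+∣q∣ (a ℚ.- b) (c ℚ.- d) ⟩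
    ℚ.∣ a ℚ.- b ∣ ℚ.+ ℚ.∣ c ℚ.- d ∣     <⟨ ℚₚ.+-mono-<
                                             (close₁ (ℕₚ.m⊔n≤o⇒m≤o M₁ M₂ M≤m) (ℕₚ.m⊔n≤o⇒m≤o M₁ M₂ M≤n))
                                             (close₂ (ℕₚ.m⊔n≤o⇒n≤o M₁ M₂ M≤m) (ℕₚ.m⊔n≤o⇒n≤o M₁ M₂ M≤n)) ⟩
    ε ℚ.* ½ ℚ.+ ε ℚ.* ½                 ≡⟨ half+half ε ⟩
    ε                                   ∎
  where
  open ℚₚ.≤-Reasoning
  rearrange : ∀ a b c d → (a ℚ.- c) ℚ.- (b ℚ.- d) ≡ (a ℚ.- b) ℚ.- (c ℚ.- d)
  rearrange = solve 4 (λ a b c d → (a :- c) :- (b :- d) := (a :- b) :- (c :- d)) refl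
    where open +-*-Solver

∣_∣ : ℝ → ℝ
∣_∣ = lipschitz ℚ.∣_∣ ∣∣-lipschitz

_÷_ : ℝ → (n : ℕ) .{{_ : NonZero n}} → ℝ
x ÷ n = lipschitz (ℚ._* ((+ 1) ℚ./ n))
  (*-lipschitz _ (proj₁ (1/n-bounds n)) (proj₂ (1/n-bounds n))) x

≤-refl : Reflexive _≤_
≤-refl {x} 0<ε = 0 , λ {n} _ → p≤p+ε (seq x n) 0<ε

≤-trans : Transitive _≤_
≤-trans {x} {y} {z} x≤y y≤z {ε} 0<ε with x≤y (half 0<ε) | y≤z (half 0<ε)
... | M₁ , le₁ | M₂ , le₂ = M₁ ℕ.⊔ M₂ , λ {n} M≤n → begin
  seq x n                               ≤⟨ le₁ (ℕₚ.m⊔n≤o⇒m≤o M₁ M₂ M≤n) ⟩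
  seq y n ℚ.+ ε ℚ.* ½                   ≤⟨ ℚₚ.+-monoˡ-≤ (ε ℚ.* ½) (le₂ (ℕₚ.m⊔n≤o⇒n≤o M₁ M₂ M≤n)) ⟩
  seq z n ℚ.+ ε ℚ.* ½ ℚ.+ ε ℚ.* ½       ≡⟨ ℚₚ.+-assoc (seq z n) (ε ℚ.* ½) (ε ℚ.* ½) ⟩
  seq z n ℚ.+ (ε ℚ.* ½ ℚ.+ ε ℚ.* ½)     ≡⟨ cong (seq z n ℚ.+_) (half+half ε) ⟩
  seq z n ℚ.+ ε                         ∎
  where open ℚₚ.≤-Reasoning

private

  eventually-≤ : ∀ {x y} M → (∀ {n} → M ℕ.≤ n → seq x n ℚ.≤ seq y n) → x ≤ y
  eventually-≤ {y = y} M le 0<ε = M , λ {n} M≤n → ℚₚ.≤-trans (le M≤n) (p≤p+ε (seq y n) 0<ε)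

ℝ≥0 : Set
ℝ≥0 = Σ ℝ (0ℝ ≤_)

-- Monotonicity implies that f respects _≃_, so an f : ℝ≥0 → ℝ≥0 that is
-- NonDecreasing is automatically a function on the real half-line.
NonDecreasing : (ℝ≥0 → ℝ≥0) → Set
NonDecreasing f = ∀ s t → proj₁ s ≤ proj₁ t → proj₁ (f s) ≤ proj₁ (f t)

Continuous : (ℝ≥0 → ℝ≥0) → Set
Continuous f = ∀ s ε → 0ℝ < ε → ∃[ δ ] 0ℝ < δ ×
  (∀ t → ∣ proj₁ t - proj₁ s ∣ < δ → ∣ proj₁ (f t) - proj₁ (f s) ∣ < ε)

infix 4 _⟶_

_⟶_ : ((N : ℕ) → .{{NonZero N}} → ℝ) → ℝ → Set
a ⟶ l = ∀ ε → 0ℝ < ε → ∃[ M ] (∀ N .{{_ : NonZero N}} → M ℕ.≤ N → ∣ a N - l ∣ < ε)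

InfinitelyMany : (ℕ → Set) → Set
InfinitelyMany P = ∀ M → ∃[ N ] M ℕ.≤ N × P N

-- Excluded middle is needed to decide comparisons of real numbers, hence
-- to sort points and to count pairs and distinct gap lengths.

module Classical (em : ExcludedMiddle 0ℓ) where

  ≤-total : Total _≤_
  ≤-total x y with em {∃[ η ] 0ℚ ℚ.< η × ∃[ M ] (∀ {n} → M ℕ.≤ n → seq y n ℚ.+ η ℚ.≤ seq x n)}
  ... | yes (η , 0<η , M , le) = inj₂ (eventually-≤ {y} {x} M λ {n} M≤n →
    ℚₚ.≤-trans (p≤p+ε (seq y n) 0<η) (le M≤n))
  ... | no ¬y<x = inj₁ x≤y
    where
    open ℚₚ.≤-Reasoning
    x≤y : x ≤ y
    x≤y {ε} 0<ε with cauchy x (ℚₚ.*-monoˡ-<-pos ⅕ 0<ε) | cauchy y (ℚₚ.*-monoˡ-<-pos ⅕ 0<ε)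
    ... | M₁ , close₁ | M₂ , close₂ = compare
      where
      η = ε ℚ.* ⅕
      M = M₁ ℕ.⊔ M₂
      X = seq x M
      Y = seq y M
      compare : ∃[ M ] (∀ {n} → M ℕ.≤ n → seq x n ℚ.≤ seq y n ℚ.+ ε)
      compare with X ℚₚ.≤? Y ℚ.+ η ℚ.+ η ℚ.+ η
      ... | yes X≤Y+3η = M , λ {n} M≤n → begin
        seq x n                                   ≤⟨ close⇒≤ (seq x n) X (close₁ (ℕₚ.m⊔n≤o⇒m≤o M₁ M₂ M≤n) (ℕₚ.m≤m⊔n M₁ M₂)) ⟩
        X ℚ.+ η                                   ≤⟨ ℚₚ.+-monoˡ-≤ η X≤Y+3η ⟩
        Y ℚ.+ η ℚ.+ η ℚ.+ η ℚ.+ η                 ≤⟨ +4η {Y} {seq y n ℚ.+ η} (close⇒≤ Y (seq y n) (close₂ (ℕₚ.m≤n⊔m M₁ M₂) (ℕₚ.m⊔n≤o⇒n≤o M₁ M₂ M≤n))) ⟩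
        seq y n ℚ.+ η ℚ.+ η ℚ.+ η ℚ.+ η ℚ.+ η     ≡⟨ reassoc (seq y n) η ⟩
        seq y n ℚ.+ (η ℚ.+ η ℚ.+ η ℚ.+ η ℚ.+ η)   ≡⟨ cong (seq y n ℚ.+_) (+5×1/5 ε) ⟩
        seq y n ℚ.+ ε                             ∎
        where
        +4η : ∀ {p q} → p ℚ.≤ q → p ℚ.+ η ℚ.+ η ℚ.+ η ℚ.+ η ℚ.≤ q ℚ.+ η ℚ.+ η ℚ.+ η ℚ.+ η
        +4η p≤q = ℚₚ.+-monoˡ-≤ η (ℚₚ.+-monoˡ-≤ η (ℚₚ.+-monoˡ-≤ η (ℚₚ.+-monoˡ-≤ η p≤q)))
        reassoc : ∀ q e → q ℚ.+ e ℚ.+ e ℚ.+ e ℚ.+ e ℚ.+ e ≡ q ℚ.+ (e ℚ.+ e ℚ.+ e ℚ.+ e ℚ.+ e)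
        reassoc = solve 2 (λ q e → q :+ e :+ e :+ e :+ e :+ e := q :+ (e :+ e :+ e :+ e :+ e)) refl
          where open +-*-Solver
      ... | no X≰Y+3η = ⊥-elim (¬y<x (η , ℚₚ.*-monoˡ-<-pos ⅕ 0<ε , M , λ {n} M≤n → begin
        seq y n ℚ.+ η                   ≤⟨ ℚₚ.+-monoˡ-≤ η (close⇒≤ (seq y n) Y (close₂ (ℕₚ.m⊔n≤o⇒n≤o M₁ M₂ M≤n) (ℕₚ.m≤n⊔m M₁ M₂))) ⟩
        Y ℚ.+ η ℚ.+ η                   ≡⟨ cancel (Y ℚ.+ η ℚ.+ η) η ⟨
        Y ℚ.+ η ℚ.+ η ℚ.+ η ℚ.- η       ≤⟨ ℚₚ.+-monoˡ-≤ (ℚ.- η) (ℚₚ.<⇒≤ (ℚₚ.≰⇒> X≰Y+3η)) ⟩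
        X ℚ.- η                         ≤⟨ ℚₚ.+-monoˡ-≤ (ℚ.- η) (close⇒≤ X (seq x n) (close₁ (ℕₚ.m≤m⊔n M₁ M₂) (ℕₚ.m⊔n≤o⇒m≤o M₁ M₂ M≤n))) ⟩
        seq x n ℚ.+ η ℚ.- η             ≡⟨ cancel (seq x n) η ⟩
        seq x n                         ∎))
        where
        cancel : ∀ q e → q ℚ.+ e ℚ.- e ≡ q
        cancel = solve 2 (λ q e → q :+ e :- e := q) refl
          where open +-*-Solver

  ≤-decTotalOrder : DecTotalOrder 0ℓ 0ℓ 0ℓ
  ≤-decTotalOrder = record
    { Carrier         = ℝ
    ; _≈_             = _≃_
    ; _≤_             = _≤_
    ; isDecTotalOrder = record
      { isTotalOrder = record
        { isPartialOrder = record
          { isPreorder = record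
            { isEquivalence = record
              { refl  = λ {x} → ≤-refl {x} , ≤-refl {x}
              ; sym   = swap
              ; trans = λ {x y z} p q →
                  ≤-trans {x} {y} {z} (proj₁ p) (proj₁ q) , ≤-trans {z} {y} {x} (proj₂ q) (proj₂ p)
              }
            ; reflexive = proj₁
            ; trans     = λ {x y z} → ≤-trans {x} {y} {z}
            }
          ; antisym = _,_
          }
        ; total = ≤-total
        }
      ; _≟_  = λ _ _ → em
      ; _≤?_ = λ _ _ → em
      }
    }

  open DecTotalOrder ≤-decTotalOrder public using (_≟_; _≤?_; totalOrder)
  open Sort ≤-decTotalOrder public using (sort)
  open Extrema totalOrder using (argmin; f[argmin]≤v⁺)

  -- If ∣x∣ ≤ b then it suffices to minimise over the integers of absolute
  -- value at most 2b, since 0 is at least as close to x as any other one.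
  nearestInteger : ∀ x → ∃[ z ] ∀ w → ∣ x - fromInt z ∣ ≤ ∣ x - fromInt w ∣
  nearestInteger x with cauchy x {1ℚ} (ℚₚ.positive⁻¹ 1ℚ)
  ... | M , close with archimedean (ℚ.∣ seq x M ∣ ℚ.+ 1ℚ)
  ...   | b , bound = argmin dist (+ 0) candidates , minimal
    where
    open ℚₚ.≤-Reasoning

    dist : ℤ → ℝ
    dist z = ∣ x - fromInt z ∣

    candidates : List ℤ
    candidates = map +_ (upTo (suc (b ℕ.+ b))) ++ map -[1+_] (upTo (suc (b ℕ.+ b)))

    ∈-candidates : ∀ w → ℤ.∣ w ∣ ℕ.≤ b ℕ.+ b → w ∈ candidates
    ∈-candidates (+ n)    le = ∈-++⁺ˡ (∈-map⁺ +_ (∈-upTo⁺ (ℕ.s≤s le)))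
    ∈-candidates -[1+ n ] le =
      ∈-++⁺ʳ (map +_ (upTo (suc (b ℕ.+ b)))) (∈-map⁺ -[1+_] (∈-upTo⁺ (ℕₚ.m≤n⇒m≤1+n le)))

    B : ℚ
    B = fromℤ (+ b)

    bounded : ∀ {n} → M ℕ.≤ n → ℚ.∣ seq x n ∣ ℚ.≤ B
    bounded {n} M≤n = begin
      ℚ.∣ seq x n ∣                                       ≤⟨ ∣p∣≤∣q∣+∣p-q∣ (seq x n) (seq x M) ⟩
      ℚ.∣ seq x M ∣ ℚ.+ ℚ.∣ seq x n ℚ.- seq x M ∣         ≤⟨ ℚₚ.+-monoʳ-≤ ℚ.∣ seq x M ∣ (ℚₚ.<⇒≤ (close M≤n ℕₚ.≤-refl)) ⟩
      ℚ.∣ seq x M ∣ ℚ.+ 1ℚ                                ≤⟨ bound ⟩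
      B                                                   ∎

    far : ∀ w → b ℕ.+ b ℕ.≤ ℤ.∣ w ∣ → dist (+ 0) ≤ dist w
    far w 2b≤∣w∣ = eventually-≤ {dist (+ 0)} {dist w} M λ {n} M≤n →
      let X = seq x n
          W = fromℤ w
      in begin
        ℚ.∣ X ℚ.- 0ℚ ∣                      ≡⟨ cong ℚ.∣_∣ (ℚₚ.+-identityʳ X) ⟩
        ℚ.∣ X ∣                             ≤⟨ bounded M≤n ⟩
        B                                   ≡⟨ cancel B ⟨
        (B ℚ.+ B) ℚ.- B                     ≤⟨ ℚₚ.+-monoˡ-≤ (ℚ.- B) 2B≤∣W∣ ⟩
        ℚ.∣ W ∣ ℚ.- B                       ≤⟨ p≤q+r⇒p-q≤r {ℚ.∣ W ∣} {B} {ℚ.∣ W ℚ.- X ∣} (begin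
          ℚ.∣ W ∣                             ≤⟨ ∣p∣≤∣q∣+∣p-q∣ W X ⟩
          ℚ.∣ X ∣ ℚ.+ ℚ.∣ W ℚ.- X ∣           ≤⟨ ℚₚ.+-monoˡ-≤ ℚ.∣ W ℚ.- X ∣ (bounded M≤n) ⟩
          B ℚ.+ ℚ.∣ W ℚ.- X ∣                 ∎) ⟩
        ℚ.∣ W ℚ.- X ∣                       ≡⟨ ∣p-q∣≡∣q-p∣ W X ⟩
        ℚ.∣ X ℚ.- W ∣                       ∎
      where
      cancel : ∀ q → (q ℚ.+ q) ℚ.- q ≡ q
      cancel = solve 1 (λ q → (q :+ q) :- q := q) refl
        where open +-*-Solver
      2B≤∣W∣ : B ℚ.+ B ℚ.≤ ℚ.∣ fromℤ w ∣
      2B≤∣W∣ = begin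
        B ℚ.+ B                   ≡⟨ fromℤ-+ ⟩
        fromℤ (+ (b ℕ.+ b))       ≤⟨ fromℤ-mono (ℤ.+≤+ 2b≤∣w∣) ⟩
        fromℤ (+ ℤ.∣ w ∣)         ≡⟨ ∣fromℤ∣ w ⟨
        ℚ.∣ fromℤ w ∣             ∎
        where
        fromℤ-+ : B ℚ.+ B ≡ fromℤ (+ (b ℕ.+ b))
        fromℤ-+ = trans
          (cong (ℚ._/ 1) (cong₂ ℤ._+_ (ℤₚ.*-identityʳ (+ b)) (ℤₚ.*-identityʳ (+ b))))
          (ℚₚ.↥p/↧p≡p (fromℤ (+ (b ℕ.+ b))))

    minimal : ∀ w → dist (argmin dist (+ 0) candidates) ≤ dist w
    minimal w = f[argmin]≤v⁺ {f = dist} {v = dist w} (+ 0) candidates (attained (ℤ.∣ w ∣ ℕₚ.≤? b ℕ.+ b))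
      where
      attained : Dec (ℤ.∣ w ∣ ℕ.≤ b ℕ.+ b) → dist (+ 0) ≤ dist w ⊎ Any (λ z → dist z ≤ dist w) candidates
      attained (yes near) = inj₂ (lose {P = λ z → dist z ≤ dist w} (∈-candidates w near) (≤-refl {dist w}))
      attained (no ¬near) = inj₁ (far w (ℕₚ.<⇒≤ (ℕₚ.≰⇒> ¬near)))

  -- min { ∣ x - z ∣ : z ∈ ℤ }
  ‖_‖ : ℝ → ℝ
  ‖ x ‖ = ∣ x - fromInt (proj₁ (nearestInteger x)) ∣

  -- Sequences are indexed from 0, so the first N terms are x 0 , … , x (N - 1).
  R : (ℕ → ℝ) → ℝ≥0 → (N : ℕ) → .{{NonZero N}} → ℕ
  R x (s , _) N = length (filter close? (cartesianProduct (upTo N) (upTo N)))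
    where
    Close : ℕ × ℕ → Set
    Close (i , j) = i ≢ j × ‖ x i - x j ‖ ≤ s ÷ N

    close? : Decidable Close
    close? _ = em

  HasPairCorrelations : (ℝ≥0 → ℝ≥0) → (ℕ → ℝ) → Set
  HasPairCorrelations f x = ∀ s → (λ N → fromNat (R x s N) ÷ N) ⟶ proj₁ (f s)

  -- The points are sorted, so the second list is y₂ , … , y_N , y₁.
  gapLengths : List ℝ → List ℝ
  gapLengths points = zipWith (λ y y′ → ‖ y′ - y ‖) ys (drop 1 ys ++ take 1 ys)
    where
    ys = sort points

  distinctGapLengths : (ℕ → ℝ) → ℕ → ℕ
  distinctGapLengths x N = length (deduplicate _≟_ (gapLengths (map x (upTo N))))

{-# OPTIONS --safe #-}

-- Fix N with at most k gap lengths.  Since the number of coincidences R(0,N)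
-- is O(N), a positive proportion of the N gaps is non-zero, so some single
-- gap length d > 0 is attained by at least N/A pairs, for a constant A; as the
-- gaps sum to at most 1, d ≤ A/N.  Bisecting (0,A] yields a point s such that,
-- for intervals (a,b] shrinking to s, infinitely many such N have d in
-- (a/N,b/N].  For those N, R(b,N)/N - R(a,N)/N ≥ 1/A, so the limits satisfy
-- f(b) - f(a) ≥ 1/A, contradicting the continuity of f at s.

module Submission where

open import Axiom.ExcludedMiddle using (ExcludedMiddle)
open import Data.Empty using (⊥)
open import Data.Integer.Base as ℤ using (+_)
import Data.Integer.Properties as ℤₚ
open import Data.List.Base using (List; []; _∷_; _++_; map; length; filter; upTo; cartesianProduct; deduplicate; zipWith; take; drop)
open import Data.List.Membership.Propositional using (_∈_; find)
open import Data.List.Membership.Propositional.Properties using (∈-∃++; ∈-++⁺ˡ; ∈-++⁺ʳ; ∈-++⁻; ∈-map⁻; ∈-filter⁺; ∈-filter⁻; ∈-cartesianProduct⁺; ∈-cartesianProduct⁻; ∈-upTo⁺; ∈-upTo⁻)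
open import Data.List.Properties using (length-++; length-map; length-upTo)
open import Data.List.Relation.Binary.Permutation.Propositional using (_↭_; ↭-sym; ↭⇒↭ₛ)
import Data.List.Relation.Binary.Permutation.Propositional.Properties as Perm
import Data.List.Relation.Binary.Permutation.Setoid.Properties as PermSetoid
open import Data.List.Relation.Binary.Sublist.Propositional using (⊆-refl)
import Data.List.Relation.Binary.Sublist.Propositional.Properties as Sublist
import Data.List.Relation.Unary.All as All
open import Data.List.Relation.Unary.AllPairs using ([]; _∷_)
open import Data.List.Relation.Unary.Any as Any using (here; there)
import Data.List.Relation.Unary.Any.Properties as Any
open import Data.List.Relation.Unary.Linked using (Linked; _∷_)
import Data.List.Relation.Unary.Linked.Properties as Linked
open import Data.List.Relation.Unary.Unique.Propositional using (Unique)
import Data.List.Relation.Unary.Unique.Propositional.Properties as Unique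
import Data.List.Sort as Sort
open import Data.Nat.Base as ℕ using (ℕ; zero; suc; NonZero; z≤n; s≤s)
import Data.Nat.Properties as ℕₚ
open import Data.Nat.Tactic.RingSolver using (solve-∀)
open import Data.Product.Base using (Σ; _×_; ∃-syntax; _,_; proj₁; proj₂)
open import Data.Rational.Base as ℚ using (ℚ; mkℚ; 0ℚ; 1ℚ; ½)
open import Data.Rational.Literals using (fromℤ)
import Data.Rational.Properties as ℚₚ
open import Data.Rational.Solver using (module +-*-Solver)
import Data.Rational.Unnormalised.Base as ℚᵘ
import Data.Rational.Unnormalised.Properties as ℚᵘₚ
open import Data.Sum.Base using (_⊎_; inj₁; inj₂; [_,_])
open import Function.Base using (_∘_)
open import Level using (0ℓ)
open import Relation.Binary.Definitions using (Transitive)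
open import Relation.Binary.PropositionalEquality using (_≡_; _≢_; refl; sym; trans; cong; cong₂; subst; subst₂; setoid; module ≡-Reasoning)
open import Relation.Nullary using (Dec; ¬_; yes; no; ¬?; contradiction)
open import Relation.Nullary.Decidable using (decidable-stable)
open import Relation.Unary using (Pred; Decidable)
open import Defs

-- Write C for a bound on R(0,N)/N. Few gap lengths say nothing as long as most gaps may be 0, and
-- the limit at 0 is what excludes this: a run of r equal points contains quadratically many
-- coincident pairs, so few runs would give more than C N of them. Counting with the threshold h =
-- C+1 makes this a linear bound, N ≤ (C+1)²(B+1), where B is the number of non-zero gaps inside the
-- sorted list. Sharing B among k lengths leads to A = 2(k+1)(C+1)². The frequent length d changes
-- with N, so only an accumulation point s of the numbers N d is available; bisection represents it
-- by the rational left endpoints. The order of choices is essential: continuity at s fixes the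
-- interval, and only then is a large N drawn from the spikes in it. Thus, apart from 0, the limits
-- are used at the two rational endpoints and never at s itself.

-- Rational arithmetic and the embedding of the naturals.

fromℕ : ℕ → ℚ
fromℕ n = fromℤ (+ n)

fromℤ-homo-+ : ∀ i j → fromℤ (i ℤ.+ j) ≡ fromℤ i ℚ.+ fromℤ j
fromℤ-homo-+ i j = sym (ℚₚ.toℚᵘ-injective (ℚᵘₚ.≃-trans (ℚₚ.toℚᵘ-homo-+ (fromℤ i) (fromℤ j))
  (ℚᵘ.*≡* (cong (ℤ._* + 1) (cong₂ ℤ._+_ (ℤₚ.*-identityʳ i) (ℤₚ.*-identityʳ j))))))

fromℕ-homo-+ : ∀ m n → fromℕ (m ℕ.+ n) ≡ fromℕ m ℚ.+ fromℕ n
fromℕ-homo-+ m n = fromℤ-homo-+ (+ m) (+ n)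

fromℕ-homo-* : ∀ m n → fromℕ (m ℕ.* n) ≡ fromℕ m ℚ.* fromℕ n
fromℕ-homo-* m n = sym (ℚₚ.toℚᵘ-injective (ℚᵘₚ.≃-trans (ℚₚ.toℚᵘ-homo-* (fromℕ m) (fromℕ n))
  (ℚᵘ.*≡* (cong (ℤ._* + 1) (sym (ℤₚ.pos-* m n))))))

fromℕ-mono-≤ : ∀ {m n} → m ℕ.≤ n → fromℕ m ℚ.≤ fromℕ n
fromℕ-mono-≤ m≤n = ℚ.*≤* (ℤₚ.*-monoʳ-≤-nonNeg (+ 1) (ℤ.+≤+ m≤n))

fromℕ-mono-< : ∀ {m n} → m ℕ.< n → fromℕ m ℚ.< fromℕ n
fromℕ-mono-< m<n = ℚ.*<* (ℤₚ.*-monoʳ-<-pos (+ 1) (ℤ.+<+ m<n))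

fromℕ-cancel-≤ : ∀ {m n} → fromℕ m ℚ.≤ fromℕ n → m ℕ.≤ n
fromℕ-cancel-≤ m≤n = ℕₚ.≮⇒≥ λ n<m → ℚₚ.<-irrefl refl (ℚₚ.<-≤-trans (fromℕ-mono-< n<m) m≤n)

≤fromℕ : ∀ q → ∃[ b ] q ℚ.≤ fromℕ b
≤fromℕ q@(mkℚ i d-1 _) = ℤ.∣ i ∣ , ℚ.*≤* (begin
  i ℤ.* + 1                     ≡⟨ ℤₚ.*-identityʳ i ⟩
  i                             ≤⟨ i≤∣i∣ i ⟩
  + ℤ.∣ i ∣                     ≤⟨ ℤ.+≤+ (ℕₚ.m≤m*n ℤ.∣ i ∣ (suc d-1)) ⟩
  + (ℤ.∣ i ∣ ℕ.* suc d-1)       ≡⟨ ℤₚ.pos-* ℤ.∣ i ∣ (suc d-1) ⟩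
  + ℤ.∣ i ∣ ℤ.* + suc d-1       ∎)
  where
  open ℤₚ.≤-Reasoning
  i≤∣i∣ : ∀ i → i ℤ.≤ + ℤ.∣ i ∣
  i≤∣i∣ (+ n)      = ℤₚ.≤-refl
  i≤∣i∣ ℤ.-[1+ n ] = ℤ.-≤+

infix 8 1/_

1/_ : ∀ n .{{_ : NonZero n}} → ℚ
1/ n = (+ 1) ℚ./ n

n*1/n≡1 : ∀ n .{{_ : NonZero n}} → fromℕ n ℚ.* 1/ n ≡ 1ℚ
n*1/n≡1 n@(suc n-1) = ℚₚ.toℚᵘ-injective (ℚᵘₚ.≃-trans (ℚₚ.toℚᵘ-homo-* (fromℕ n) (1/ n))
  (ℚᵘₚ.≃-trans (ℚᵘₚ.*-congˡ {ℚ.toℚᵘ (fromℕ n)} (ℚₚ.toℚᵘ-fromℚᵘ (ℚᵘ.mkℚᵘ (+ 1) n-1)))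
  (ℚᵘ.*≡* (trans (ℤₚ.*-identityʳ _) (trans (ℤₚ.*-identityʳ (+ n)) (sym (trans (ℤₚ.*-identityˡ _) (cong +_ (ℕₚ.*-identityˡ n)))))))))

1/-pos : ∀ n .{{_ : NonZero n}} → 0ℚ ℚ.< 1/ n
1/-pos n@(suc _) = ℚₚ.positive⁻¹ (1/ n) {{ℚₚ.normalize-pos 1 n}}

-- Turns linear reasoning into a ring identity: the hypotheses are added up to `a ≤ b`, and the
-- solver checks that both inequalities have the same slack.
≤-by : ∀ {a b u v} → a ℚ.≤ b → v ℚ.- u ≡ b ℚ.- a → u ℚ.≤ v
≤-by {a} {b} {u} {v} a≤b e = subst₂ ℚ._≤_ lhs rhs (ℚₚ.+-monoʳ-≤ (v ℚ.- b) a≤b)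
  where
  open +-*-Solver
  lhs : v ℚ.- b ℚ.+ a ≡ u
  lhs = trans (solve 3 (λ a b v → v :- b :+ a := v :- (b :- a)) refl a b v)
    (trans (cong (λ t → v ℚ.- t) (sym e)) (solve 2 (λ u v → v :- (v :- u) := u) refl u v))
  rhs : v ℚ.- b ℚ.+ b ≡ v
  rhs = solve 2 (λ b v → v :- b :+ b := v) refl b v

p≤∣p∣ : ∀ p → p ℚ.≤ ℚ.∣ p ∣
p≤∣p∣ p with ℚₚ.≤-total 0ℚ p
... | inj₁ 0≤p = ℚₚ.≤-reflexive (sym (ℚₚ.0≤p⇒∣p∣≡p 0≤p))
... | inj₂ p≤0 = ℚₚ.≤-trans p≤0 (ℚₚ.0≤∣p∣ p)

-p≤∣p∣ : ∀ p → ℚ.- p ℚ.≤ ℚ.∣ p ∣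
-p≤∣p∣ p = subst (ℚ.- p ℚ.≤_) (ℚₚ.∣-p∣≡∣p∣ p) (p≤∣p∣ (ℚ.- p))

∣p∣≤ : ∀ {p r} → p ℚ.≤ r → ℚ.- p ℚ.≤ r → ℚ.∣ p ∣ ℚ.≤ r
∣p∣≤ {p} p≤r -p≤r with ℚₚ.∣p∣≡p∨∣p∣≡-p p
... | inj₁ e = subst (ℚ._≤ _) (sym e) p≤r
... | inj₂ e = subst (ℚ._≤ _) (sym e) -p≤r

∣p-q∣≤⇒p≤q+ : ∀ p q {r} → ℚ.∣ p ℚ.- q ∣ ℚ.≤ r → p ℚ.≤ q ℚ.+ r
∣p-q∣≤⇒p≤q+ p q {r} h = ≤-by (ℚₚ.≤-trans (p≤∣p∣ _) h)
  (solve 3 (λ p q r → q :+ r :- p := r :- (p :- q)) refl p q r)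
  where open +-*-Solver

∣p-q∣≤⇒q≤p+ : ∀ p q {r} → ℚ.∣ p ℚ.- q ∣ ℚ.≤ r → q ℚ.≤ p ℚ.+ r
∣p-q∣≤⇒q≤p+ p q {r} h = ≤-by (ℚₚ.≤-trans (-p≤∣p∣ (p ℚ.- q)) h)
  (solve 3 (λ p q r → p :+ r :- q := r :- :- (p :- q)) refl p q r)
  where open +-*-Solver

0<p*½ : ∀ {p} → 0ℚ ℚ.< p → 0ℚ ℚ.< p ℚ.* ½
0<p*½ 0<p = ℚₚ.*-monoˡ-<-pos ½ 0<p

p≤q+ε⇒p≤q : ∀ {p q} → (∀ {ε} → 0ℚ ℚ.< ε → p ℚ.≤ q ℚ.+ ε) → p ℚ.≤ q
p≤q+ε⇒p≤q {p} {q} h = ℚₚ.≮⇒≥ λ q<p →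
  let 0<p-q = subst (ℚ._< p ℚ.- q) (ℚₚ.+-inverseʳ q) (ℚₚ.+-monoˡ-< (ℚ.- q) q<p)
      0<ε   = 0<p*½ 0<p-q
  in ℚₚ.<-irrefl refl (ℚₚ.<-≤-trans 0<ε (≤-by (h 0<ε)
       (solve 2 (λ p q → con 0ℚ :- (p :- q) :* con ½ := q :+ (p :- q) :* con ½ :- p) refl p q)))
  where open +-*-Solver

-- Arithmetic of runs of equal points.

private

  -- The two bounds together have min(r+1, h) as the last factor: the current run still owes h for
  -- each of its last elements, and at most h elements owe. A new head with at least h later
  -- relatives pays its own h through its `suc r′` pairs; otherwise the run is still short and the
  -- first bound implies the second.
  extend-run : ∀ {h l q d r r′} → r ℕ.≤ r′ →
    h ℕ.* suc l ℕ.≤ q ℕ.+ d ℕ.+ h ℕ.* suc r × h ℕ.* suc l ℕ.≤ q ℕ.+ d ℕ.+ h ℕ.* h →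
    h ℕ.* suc (suc l) ℕ.≤ suc r′ ℕ.+ q ℕ.+ d ℕ.+ h ℕ.* suc (suc r′) × h ℕ.* suc (suc l) ℕ.≤ suc r′ ℕ.+ q ℕ.+ d ℕ.+ h ℕ.* h
  extend-run {h} {l} {q} {d} {r} {r′} r≤r′ (bound , capped) = ℕₚ.≤-trans step
    (ℕₚ.+-mono-≤ (ℕₚ.+-monoˡ-≤ d (ℕₚ.m≤n+m q (suc r′))) (ℕₚ.*-monoʳ-≤ h (s≤s (s≤s r≤r′)))) , capped′
    where
    open ℕₚ.≤-Reasoning
    step : h ℕ.* suc (suc l) ℕ.≤ q ℕ.+ d ℕ.+ h ℕ.* suc (suc r)
    step = begin
      h ℕ.* suc (suc l)                   ≡⟨ ℕₚ.*-suc h (suc l) ⟩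
      h ℕ.+ h ℕ.* suc l                   ≤⟨ ℕₚ.+-monoʳ-≤ h bound ⟩
      h ℕ.+ (q ℕ.+ d ℕ.+ h ℕ.* suc r)     ≡⟨ eq h (q ℕ.+ d) r ⟩
      q ℕ.+ d ℕ.+ h ℕ.* suc (suc r)       ∎
      where
      eq : ∀ h e r → h ℕ.+ (e ℕ.+ h ℕ.* (1 ℕ.+ r)) ≡ e ℕ.+ h ℕ.* (2 ℕ.+ r)
      eq = solve-∀
    capped′ : h ℕ.* suc (suc l) ℕ.≤ suc r′ ℕ.+ q ℕ.+ d ℕ.+ h ℕ.* h
    capped′ with ℕₚ.≤-<-connex h (suc r′)
    ... | inj₁ h≤r′ = begin
      h ℕ.* suc (suc l)                   ≡⟨ ℕₚ.*-suc h (suc l) ⟩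
      h ℕ.+ h ℕ.* suc l                   ≤⟨ ℕₚ.+-mono-≤ h≤r′ capped ⟩
      suc r′ ℕ.+ (q ℕ.+ d ℕ.+ h ℕ.* h)    ≡⟨ eq (suc r′) q d (h ℕ.* h) ⟩
      suc r′ ℕ.+ q ℕ.+ d ℕ.+ h ℕ.* h      ∎
      where
      eq : ∀ s q d e → s ℕ.+ (q ℕ.+ d ℕ.+ e) ≡ s ℕ.+ q ℕ.+ d ℕ.+ e
      eq = solve-∀
    ... | inj₂ r′<h = begin
      h ℕ.* suc (suc l)                       ≤⟨ step ⟩
      q ℕ.+ d ℕ.+ h ℕ.* suc (suc r)           ≤⟨ ℕₚ.+-mono-≤ (ℕₚ.+-monoˡ-≤ d (ℕₚ.m≤n+m q (suc r′)))
                                                   (ℕₚ.*-monoʳ-≤ h (ℕₚ.≤-trans (s≤s (s≤s r≤r′)) r′<h)) ⟩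
      suc r′ ℕ.+ q ℕ.+ d ℕ.+ h ℕ.* h          ∎

  -- The break contributes h², exactly the largest debt of the run that ends here. The new head owes
  -- h, which either form of the last term covers.
  break-run : ∀ h .{{_ : NonZero h}} {l q b r} r′ →
    h ℕ.* suc l ℕ.≤ q ℕ.+ h ℕ.* h ℕ.* b ℕ.+ h ℕ.* suc r × h ℕ.* suc l ℕ.≤ q ℕ.+ h ℕ.* h ℕ.* b ℕ.+ h ℕ.* h →
    h ℕ.* suc (suc l) ℕ.≤ r′ ℕ.+ q ℕ.+ h ℕ.* h ℕ.* suc b ℕ.+ h ℕ.* suc r′ ×
    h ℕ.* suc (suc l) ℕ.≤ r′ ℕ.+ q ℕ.+ h ℕ.* h ℕ.* suc b ℕ.+ h ℕ.* h
  break-run h {l} {q} {b} r′ (_ , capped) = bound (ℕₚ.m≤m*n h (suc r′)) , bound (ℕₚ.m≤m*n h h)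
    where
    open ℕₚ.≤-Reasoning
    bound : ∀ {e} → h ℕ.≤ e → h ℕ.* suc (suc l) ℕ.≤ r′ ℕ.+ q ℕ.+ h ℕ.* h ℕ.* suc b ℕ.+ e
    bound {e} h≤e = begin
      h ℕ.* suc (suc l)                           ≡⟨ ℕₚ.*-suc h (suc l) ⟩
      h ℕ.+ h ℕ.* suc l                           ≤⟨ ℕₚ.+-mono-≤ h≤e capped ⟩
      e ℕ.+ (q ℕ.+ h ℕ.* h ℕ.* b ℕ.+ h ℕ.* h)     ≡⟨ eq e q (h ℕ.* h) b ⟩
      q ℕ.+ h ℕ.* h ℕ.* suc b ℕ.+ e               ≤⟨ ℕₚ.+-monoˡ-≤ e (ℕₚ.+-monoˡ-≤ (h ℕ.* h ℕ.* suc b) (ℕₚ.m≤n+m q r′)) ⟩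
      r′ ℕ.+ q ℕ.+ h ℕ.* h ℕ.* suc b ℕ.+ e        ∎
      where
      eq : ∀ e q k b → e ℕ.+ (q ℕ.+ k ℕ.* b ℕ.+ k) ≡ q ℕ.+ k ℕ.* (1 ℕ.+ b) ℕ.+ e
      eq = solve-∀

-- Counting in lists: pigeonhole, adjacent pairs and runs.

module _ {A : Set} where

  Unique-⊆⇒length-≤ : ∀ {xs ys : List A} → Unique xs → (∀ {z} → z ∈ xs → z ∈ ys) → length xs ℕ.≤ length ys
  Unique-⊆⇒length-≤ {[]} _ _ = z≤n
  Unique-⊆⇒length-≤ {x ∷ xs} u@(_ ∷ xs!) xs⊆ys with ∈-∃++ (xs⊆ys (here refl))
  ... | as , bs , refl = begin
    suc (length xs)               ≤⟨ s≤s (Unique-⊆⇒length-≤ xs! without-x) ⟩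
    suc (length (as ++ bs))       ≡⟨ cong suc (length-++ as) ⟩
    suc (length as ℕ.+ length bs) ≡⟨ ℕₚ.+-suc (length as) (length bs) ⟨
    length as ℕ.+ suc (length bs) ≡⟨ length-++ as ⟨
    length (as ++ x ∷ bs)         ∎
    where
    open ℕₚ.≤-Reasoning
    without-x : ∀ {z} → z ∈ xs → z ∈ as ++ bs
    without-x z∈xs with ∈-++⁻ as (xs⊆ys (there z∈xs))
    ... | inj₁ z∈as         = ∈-++⁺ˡ z∈as
    ... | inj₂ (here refl)  = contradiction z∈xs (Unique.Unique[x∷xs]⇒x∉xs u)
    ... | inj₂ (there z∈bs) = ∈-++⁺ʳ as z∈bs

  length-filter-¬ : ∀ {P : Pred A 0ℓ} (P? : Decidable P) xs →
    length xs ≡ length (filter P? xs) ℕ.+ length (filter (¬? ∘ P?) xs)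
  length-filter-¬ P? [] = refl
  length-filter-¬ P? (x ∷ xs) with P? x
  ... | yes _ = cong suc (length-filter-¬ P? xs)
  ... | no _  = trans (cong suc (length-filter-¬ P? xs)) (sym (ℕₚ.+-suc _ _))

  -- The classes may overlap, since the elements of one class are removed before the others are
  -- counted. The factor `a` clears the denominator of a bound b/a on each class.
  pigeonhole : ∀ {B : Set} {S : B → Pred A 0ℓ} (S? : ∀ v → Decidable (S v)) a b (vs : List B) (xs : List A) →
    (∀ {x} → x ∈ xs → ∃[ v ] v ∈ vs × S v x) →
    (∀ {v} → v ∈ vs → length (filter (S? v) xs) ℕ.* a ℕ.≤ b) →
    length xs ℕ.* a ℕ.≤ length vs ℕ.* b
  pigeonhole S? a b [] [] _ _ = z≤n
  pigeonhole S? a b [] (x ∷ xs) covered _ with covered (here refl)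
  ... | _ , () , _
  pigeonhole {S = S} S? a b (v ∷ vs) xs covered small = begin
    length xs ℕ.* a                               ≡⟨ cong (ℕ._* a) (length-filter-¬ (S? v) xs) ⟩
    (length in-v ℕ.+ length rest) ℕ.* a           ≡⟨ ℕₚ.*-distribʳ-+ a (length in-v) (length rest) ⟩
    length in-v ℕ.* a ℕ.+ length rest ℕ.* a       ≤⟨ ℕₚ.+-mono-≤ (small (here refl)) (pigeonhole S? a b vs rest covered′ small′) ⟩
    b ℕ.+ length vs ℕ.* b                         ∎
    where
    open ℕₚ.≤-Reasoning
    in-v = filter (S? v) xs
    rest = filter (¬? ∘ S? v) xs
    covered′ : ∀ {x} → x ∈ rest → ∃[ w ] w ∈ vs × S w x
    covered′ x∈rest with ∈-filter⁻ (¬? ∘ S? v) {xs = xs} x∈rest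
    ... | x∈xs , ¬Svx with covered x∈xs
    ...   | _ , here refl , Svx = contradiction Svx ¬Svx
    ...   | w , there w∈vs , Swx = w , w∈vs , Swx
    small′ : ∀ {w} → w ∈ vs → length (filter (S? w) rest) ℕ.* a ℕ.≤ b
    small′ {w} w∈vs = ℕₚ.≤-trans
      (ℕₚ.*-monoˡ-≤ a (Sublist.length-mono-≤ (Sublist.filter⁺ (S? w) (S? w) (λ { refl Sx → Sx }) (Sublist.filter-⊆ (¬? ∘ S? v) xs))))
      (small (there w∈vs))

  -- The later element comes first, to match the difference `y′ - y` in `gapLengths`. The gap that
  -- closes the circle is left out.
  adjacentPairs : List A → List (A × A)
  adjacentPairs []           = []
  adjacentPairs (_ ∷ [])     = []
  adjacentPairs (x ∷ y ∷ xs) = (y , x) ∷ adjacentPairs (y ∷ xs)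

  ∈-adjacentPairs⁻ : ∀ {x y} xs → (y , x) ∈ adjacentPairs xs → y ∈ xs × x ∈ xs
  ∈-adjacentPairs⁻ (_ ∷ _ ∷ xs) (here refl) = there (here refl) , here refl
  ∈-adjacentPairs⁻ (_ ∷ z ∷ xs) (there p) with ∈-adjacentPairs⁻ (z ∷ xs) p
  ... | y∈ , x∈ = there y∈ , there x∈

  adjacentPairs! : ∀ {xs} → Unique xs → Unique (adjacentPairs xs)
  adjacentPairs! {[]}         _ = []
  adjacentPairs! {_ ∷ []}     _ = []
  adjacentPairs! {x ∷ y ∷ xs} u@(_ ∷ u′) =
    All.tabulate (λ { p refl → Unique.Unique[x∷xs]⇒x∉xs u (proj₂ (∈-adjacentPairs⁻ (y ∷ xs) p)) })
    ∷ adjacentPairs! u′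

  module Runs {Z : A → A → Set} (Z? : ∀ x → Decidable (Z x)) (Z-trans : Transitive Z) where

    relatedPairs : List A → List (A × A)
    relatedPairs []       = []
    relatedPairs (x ∷ xs) = map (_, x) (filter (Z? x) xs) ++ relatedPairs xs

    breaks : List A → List (A × A)
    breaks xs = filter (λ (y , x) → ¬? (Z? x y)) (adjacentPairs xs)

    ∈-relatedPairs⁻ : ∀ {x y xs} → Unique xs → (y , x) ∈ relatedPairs xs → (y ∈ xs × x ∈ xs) × y ≢ x × Z x y
    ∈-relatedPairs⁻ {xs = z ∷ xs} u@(_ ∷ xs!) p with ∈-++⁻ (map (_, z) (filter (Z? z) xs)) p
    ... | inj₂ q = let (y∈ , x∈) , rest = ∈-relatedPairs⁻ xs! q in (there y∈ , there x∈) , rest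
    ... | inj₁ q with ∈-map⁻ (_, z) q
    ...   | y , y∈ , refl with ∈-filter⁻ (Z? z) {xs = xs} y∈
    ...     | y∈xs , Zzy = (there y∈xs , here refl) , (λ { refl → Unique.Unique[x∷xs]⇒x∉xs u y∈xs }) , Zzy

    relatedPairs! : ∀ {xs} → Unique xs → Unique (relatedPairs xs)
    relatedPairs! {[]} _ = []
    relatedPairs! {x ∷ xs} u@(_ ∷ xs!) =
      Unique.++⁺ (Unique.map⁺ (cong proj₁) (Unique.filter⁺ (Z? x) xs!)) (relatedPairs! xs!) disjoint
      where
      disjoint : ∀ {p} → ¬ (p ∈ map (_, x) (filter (Z? x) xs) × p ∈ relatedPairs xs)
      disjoint (p , q) with ∈-map⁻ (_, x) p
      ... | _ , _ , refl = Unique.Unique[x∷xs]⇒x∉xs u (proj₂ (proj₁ (∈-relatedPairs⁻ xs! q)))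

    length-relatedPairs : ∀ x xs →
      length (relatedPairs (x ∷ xs)) ≡ length (filter (Z? x) xs) ℕ.+ length (relatedPairs xs)
    length-relatedPairs x xs = trans (length-++ (map (_, x) (filter (Z? x) xs)))
      (cong (ℕ._+ length (relatedPairs xs)) (length-map (_, x) (filter (Z? x) xs)))

    -- Every element with at least h later relatives contributes h related pairs.
    -- The others are among the last h elements of their run, and there is one
    -- more run than there are breaks.
    module _ (h-1 : ℕ) where

      private
        h = suc h-1

      run-bounds : ∀ x xs →
        let q = length (relatedPairs (x ∷ xs)) ℕ.+ h ℕ.* h ℕ.* length (breaks (x ∷ xs))
            r = length (filter (Z? x) xs)
        in h ℕ.* suc (length xs) ℕ.≤ q ℕ.+ h ℕ.* suc r × h ℕ.* suc (length xs) ℕ.≤ q ℕ.+ h ℕ.* h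
      run-bounds x [] rewrite ℕₚ.*-zeroʳ (h ℕ.* h) | ℕₚ.*-identityʳ h = ℕₚ.≤-refl , ℕₚ.m≤m*n h h
      run-bounds x (y ∷ xs) rewrite length-relatedPairs x (y ∷ xs) with Z? x y
      ... | no _    = break-run h {l = length xs} {q = length (relatedPairs (y ∷ xs))} _ (run-bounds y xs)
      ... | yes Zxy = extend-run {h} {l = length xs} {q = length (relatedPairs (y ∷ xs))} longer (run-bounds y xs)
        where
        -- By transitivity every later relative of `y` is also one of `x`.
        longer : length (filter (Z? y) xs) ℕ.≤ length (filter (Z? x) xs)
        longer = Sublist.length-mono-≤ (Sublist.filter⁺ (Z? y) (Z? x) (λ { refl → Z-trans Zxy }) (⊆-refl {x = xs}))

      length≤breaks : ∀ xs → h ℕ.* length xs ℕ.≤ length (relatedPairs xs) ℕ.+ h ℕ.* h ℕ.* suc (length (breaks xs))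
      length≤breaks []       rewrite ℕₚ.*-zeroʳ h = z≤n
      length≤breaks (x ∷ xs) = ℕₚ.≤-trans (proj₂ (run-bounds x xs)) (ℕₚ.≤-reflexive
        (eq (length (relatedPairs (x ∷ xs))) (h ℕ.* h) (length (breaks (x ∷ xs)))))
        where
        eq : ∀ q k b → q ℕ.+ k ℕ.* b ℕ.+ k ≡ q ℕ.+ k ℕ.* (1 ℕ.+ b)
        eq = solve-∀

-- Inequalities between reals and their rational approximations.

Eventually : (ℕ → Set) → Set
Eventually P = ∃[ M ] ∀ {n} → M ℕ.≤ n → P n

infixr 4 _and_

_and_ : ∀ {P Q} → Eventually P → Eventually Q → Eventually (λ n → P n × Q n)
(M₁ , p) and (M₂ , q) = M₁ ℕ.⊔ M₂ , λ M≤n → p (ℕₚ.m⊔n≤o⇒m≤o M₁ M₂ M≤n) , q (ℕₚ.m⊔n≤o⇒n≤o M₁ M₂ M≤n)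

eventually-map : ∀ {P Q} → (∀ {n} → P n → Q n) → Eventually P → Eventually Q
eventually-map f (M , p) = M , λ M≤n → f (p M≤n)

-- The way back from reals to rationals: once the approximations have been eliminated, the index no
-- longer occurs.
constantly : ∀ {A : Set} → Eventually (λ _ → A) → A
constantly (M , a) = a ℕₚ.≤-refl

p≤p+ε : ∀ {p ε} → 0ℚ ℚ.< ε → p ℚ.≤ p ℚ.+ ε
p≤p+ε {p} {ε} 0<ε = subst (ℚ._≤ p ℚ.+ ε) (ℚₚ.+-identityʳ p) (ℚₚ.+-monoʳ-≤ p (ℚₚ.<⇒≤ 0<ε))

pointwise-≤ : ∀ x y → (∀ n → seq x n ℚ.≤ seq y n) → x ≤ y
pointwise-≤ x y h 0<ε = 0 , λ {n} _ → ℚₚ.≤-trans (h n) (p≤p+ε 0<ε)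

rational : ∀ q → 0ℚ ℚ.≤ q → ℝ≥0
rational q 0≤q = fromℚ q , pointwise-≤ 0ℝ (fromℚ q) λ _ → 0≤q

÷-mono-≤ : ∀ {p q} N .{{_ : NonZero N}} → p ℚ.≤ q → fromℚ p ÷ N ≤ fromℚ q ÷ N
÷-mono-≤ {p} {q} N p≤q = pointwise-≤ (fromℚ p ÷ N) (fromℚ q ÷ N) λ _ →
  ℚₚ.*-monoʳ-≤-nonNeg (1/ N) {{ℚ.nonNegative (ℚₚ.<⇒≤ (1/-pos N))}} p≤q

0≤0÷ : ∀ N .{{_ : NonZero N}} → 0ℝ ≤ 0ℝ ÷ N
0≤0÷ N = pointwise-≤ 0ℝ (0ℝ ÷ N) λ _ → ℚₚ.≤-reflexive (sym (ℚₚ.*-zeroˡ (1/ N)))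

0÷≤0 : ∀ N .{{_ : NonZero N}} → 0ℝ ÷ N ≤ 0ℝ
0÷≤0 N = pointwise-≤ (0ℝ ÷ N) 0ℝ λ _ → ℚₚ.≤-reflexive (ℚₚ.*-zeroˡ (1/ N))

0ₛ : ℝ≥0
0ₛ = 0ℝ , ≤-refl {0ℝ}

fromℚ-cancel-≤ : ∀ {p q} → fromℚ p ≤ fromℚ q → p ℚ.≤ q
fromℚ-cancel-≤ p≤q = p≤q+ε⇒p≤q λ 0<ε → constantly (p≤q 0<ε)

-- y′ - y is eventually almost non-negative, hence almost its absolute value.
≤-shift : ∀ y y′ q r → fromℚ q ≤ ∣ y′ - y ∣ → y ≤ y′ → y′ ≤ fromℚ r → y ≤ fromℚ (r ℚ.- q)
≤-shift y y′ q r q≤ y≤y′ y′≤r {ε} 0<ε = eventually-map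
  (λ {n} (h₁ , h₂ , h₃) → bound (seq y n) (seq y′ n) h₁ h₂ h₃) (q≤ 0<δ and y≤y′ 0<δ and y′≤r 0<δ)
  where
  δ = ε ℚ.* ½ ℚ.* ½
  0<δ : 0ℚ ℚ.< δ
  0<δ = 0<p*½ (0<p*½ 0<ε)
  open +-*-Solver
  bound : ∀ a b → q ℚ.≤ ℚ.∣ b ℚ.- a ∣ ℚ.+ δ → a ℚ.≤ b ℚ.+ δ → b ℚ.≤ r ℚ.+ δ → a ℚ.≤ r ℚ.- q ℚ.+ ε
  bound a b h₁ h₂ h₃ = ≤-by (ℚₚ.+-mono-≤ (ℚₚ.≤-trans h₁ (ℚₚ.+-monoˡ-≤ δ
      (∣p∣≤ {b ℚ.- a} {b ℚ.- a ℚ.+ δ ℚ.+ δ}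
        (≤-by (ℚₚ.+-mono-≤ (ℚₚ.<⇒≤ 0<δ) (ℚₚ.<⇒≤ 0<δ))
          (solve 3 (λ a b d → b :- a :+ d :+ d :- (b :- a) := d :+ d :- (con 0ℚ :+ con 0ℚ)) refl a b δ))
        (≤-by (ℚₚ.+-mono-≤ h₂ h₂)
          (solve 3 (λ a b d → b :- a :+ d :+ d :- (:- (b :- a)) := b :+ d :+ (b :+ d) :- (a :+ a)) refl a b δ))))) h₃)
    (solve 5 (λ a b q r e → let d = e :* con ½ :* con ½ in
      r :- q :+ e :- a := b :- a :+ d :+ d :+ d :+ (r :+ d) :- (q :+ b)) refl a b q r ε)

near⇒bounded : ∀ l → ∃[ b ] ∀ q → ∣ fromℚ q - l ∣ ≤ 1ℝ → q ℚ.≤ fromℕ b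
near⇒bounded l with cauchy l {1ℚ} (ℚₚ.positive⁻¹ 1ℚ)
-- Two units come from `near`, read off with tolerance 1, and one from the Cauchy distance to
-- `seq l M`.
... | M , close with ≤fromℕ (seq l M ℚ.+ 1ℚ ℚ.+ 1ℚ ℚ.+ 1ℚ)
...   | b , le = b , λ q near → constantly (eventually-map (λ {n} (h₁ , h₂) → bound q (seq l n) h₁ h₂)
  (near (ℚₚ.positive⁻¹ 1ℚ) and (M , λ M≤n → close M≤n ℕₚ.≤-refl)))
  where
  open +-*-Solver
  bound : ∀ q t → ℚ.∣ q ℚ.- t ∣ ℚ.≤ 1ℚ ℚ.+ 1ℚ → ℚ.∣ t ℚ.- seq l M ∣ ℚ.< 1ℚ → q ℚ.≤ fromℕ b
  bound q t h₁ h₂ = ℚₚ.≤-trans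
    (≤-by (ℚₚ.+-mono-≤ (∣p-q∣≤⇒p≤q+ q t h₁) (∣p-q∣≤⇒p≤q+ t (seq l M) (ℚₚ.<⇒≤ h₂)))
      (solve 3 (λ q m t → m :+ con 1ℚ :+ con 1ℚ :+ con 1ℚ :- q
         := t :+ (con 1ℚ :+ con 1ℚ) :+ (m :+ con 1ℚ) :- (q :+ t)) refl q (seq l M) t))
    le

-- Each of the four distances on the way from `p` to `q` costs 2e: its bound `e`, and the tolerance
-- `e` at which a real inequality is read off. In the application `p`, `q` are ratios of pair
-- counts, `u`, `v` their limits, and `l` the value of f at the accumulation point.
near⇒close : ∀ p q u v l e → 0ℚ ℚ.< e →
  ∣ fromℚ p - u ∣ ≤ fromℚ e → ∣ u - l ∣ ≤ fromℚ e → ∣ fromℚ q - v ∣ ≤ fromℚ e → ∣ v - l ∣ ≤ fromℚ e →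
  q ℚ.≤ p ℚ.+ fromℕ 8 ℚ.* e
near⇒close p q u v l e 0<e p~u u~l q~v v~l = constantly (eventually-map
  (λ {n} (h₁ , h₂ , h₃ , h₄) → bound (seq u n) (seq v n) (seq l n) h₁ h₂ h₃ h₄)
  (p~u 0<e and u~l 0<e and q~v 0<e and v~l 0<e))
  where
  open +-*-Solver
  _~_ : ℚ → ℚ → Set
  a ~ b = ℚ.∣ a ℚ.- b ∣ ℚ.≤ e ℚ.+ e
  bound : ∀ u v l → p ~ u → u ~ l → q ~ v → v ~ l → q ℚ.≤ p ℚ.+ fromℕ 8 ℚ.* e
  bound u v l h₁ h₂ h₃ h₄ = ≤-by
    (ℚₚ.+-mono-≤ (ℚₚ.+-mono-≤ (∣p-q∣≤⇒q≤p+ p u h₁) (∣p-q∣≤⇒q≤p+ u l h₂))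
      (ℚₚ.+-mono-≤ (∣p-q∣≤⇒p≤q+ q v h₃) (∣p-q∣≤⇒p≤q+ v l h₄)))
    (solve 6 (λ p q u v l e → p :+ con (fromℕ 8) :* e :- q
       := p :+ (e :+ e) :+ (u :+ (e :+ e)) :+ (v :+ (e :+ e) :+ (l :+ (e :+ e))) :- (u :+ l :+ (q :+ v)))
      refl p q u v l e)

jump-in-ratios : ∀ {m n} N A .{{_ : NonZero N}} .{{_ : NonZero A}} → m ℕ.* A ℕ.+ N ℕ.≤ n ℕ.* A →
  fromℕ m ℚ.* 1/ N ℚ.+ 1/ A ℚ.≤ fromℕ n ℚ.* 1/ N
jump-in-ratios {m} {n} N A jump = subst₂ ℚ._≤_ lhs rhs
  (ℚₚ.*-monoʳ-≤-nonNeg (1/ N ℚ.* 1/ A) {{ℚ.nonNegative 0≤u}} (fromℕ-mono-≤ jump))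
  where
  open +-*-Solver
  0≤u : 0ℚ ℚ.≤ 1/ N ℚ.* 1/ A
  0≤u = subst (ℚ._≤ 1/ N ℚ.* 1/ A) (ℚₚ.*-zeroˡ (1/ A))
    (ℚₚ.*-monoʳ-≤-nonNeg (1/ A) {{ℚ.nonNegative (ℚₚ.<⇒≤ (1/-pos A))}} (ℚₚ.<⇒≤ (1/-pos N)))
  lhs : fromℕ (m ℕ.* A ℕ.+ N) ℚ.* (1/ N ℚ.* 1/ A) ≡ fromℕ m ℚ.* 1/ N ℚ.+ 1/ A
  lhs = begin
    fromℕ (m ℕ.* A ℕ.+ N) ℚ.* (1/ N ℚ.* 1/ A)
      ≡⟨ cong (ℚ._* (1/ N ℚ.* 1/ A)) (trans (fromℕ-homo-+ (m ℕ.* A) N) (cong (ℚ._+ fromℕ N) (fromℕ-homo-* m A))) ⟩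
    (fromℕ m ℚ.* fromℕ A ℚ.+ fromℕ N) ℚ.* (1/ N ℚ.* 1/ A)
      ≡⟨ solve 5 (λ m a n u v → (m :* a :+ n) :* (u :* v) := m :* u :* (a :* v) :+ n :* u :* v) refl (fromℕ m) (fromℕ A) (fromℕ N) (1/ N) (1/ A) ⟩
    fromℕ m ℚ.* 1/ N ℚ.* (fromℕ A ℚ.* 1/ A) ℚ.+ fromℕ N ℚ.* 1/ N ℚ.* 1/ A
      ≡⟨ cong₂ (λ s t → fromℕ m ℚ.* 1/ N ℚ.* s ℚ.+ t ℚ.* 1/ A) (n*1/n≡1 A) (n*1/n≡1 N) ⟩
    fromℕ m ℚ.* 1/ N ℚ.* 1ℚ ℚ.+ 1ℚ ℚ.* 1/ A
      ≡⟨ cong₂ ℚ._+_ (ℚₚ.*-identityʳ (fromℕ m ℚ.* 1/ N)) (ℚₚ.*-identityˡ (1/ A)) ⟩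
    fromℕ m ℚ.* 1/ N ℚ.+ 1/ A ∎
    where open ≡-Reasoning
  rhs : fromℕ (n ℕ.* A) ℚ.* (1/ N ℚ.* 1/ A) ≡ fromℕ n ℚ.* 1/ N
  rhs = begin
    fromℕ (n ℕ.* A) ℚ.* (1/ N ℚ.* 1/ A)
      ≡⟨ cong (ℚ._* (1/ N ℚ.* 1/ A)) (fromℕ-homo-* n A) ⟩
    fromℕ n ℚ.* fromℕ A ℚ.* (1/ N ℚ.* 1/ A)
      ≡⟨ solve 4 (λ n a u v → n :* a :* (u :* v) := n :* u :* (a :* v)) refl (fromℕ n) (fromℕ A) (1/ N) (1/ A) ⟩
    fromℕ n ℚ.* 1/ N ℚ.* (fromℕ A ℚ.* 1/ A)
      ≡⟨ cong (fromℕ n ℚ.* 1/ N ℚ.*_) (n*1/n≡1 A) ⟩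
    fromℕ n ℚ.* 1/ N ℚ.* 1ℚ
      ≡⟨ ℚₚ.*-identityʳ (fromℕ n ℚ.* 1/ N) ⟩
    fromℕ n ℚ.* 1/ N ∎
    where open ≡-Reasoning

ratio≤⇒≤* : ∀ {m b} N .{{_ : NonZero N}} → fromℕ m ℚ.* 1/ N ℚ.≤ fromℕ b → m ℕ.≤ b ℕ.* N
ratio≤⇒≤* {m} {b} N h = fromℕ-cancel-≤ (subst₂ ℚ._≤_ lhs (sym (fromℕ-homo-* b N))
  (ℚₚ.*-monoʳ-≤-nonNeg (fromℕ N) h))
  where
  open +-*-Solver
  lhs : fromℕ m ℚ.* 1/ N ℚ.* fromℕ N ≡ fromℕ m
  lhs = trans (solve 3 (λ m u n → m :* u :* n := m :* (n :* u)) refl (fromℕ m) (1/ N) (fromℕ N))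
    (trans (cong (fromℕ m ℚ.*_) (n*1/n≡1 N)) (ℚₚ.*-identityʳ (fromℕ m)))

-- Nested intervals of halving width.

width : ℚ → ℕ → ℚ
width q zero    = q
width q (suc n) = width q n ℚ.* ½

width+width : ∀ q n → width q (suc n) ℚ.+ width q (suc n) ≡ width q n
width+width q n = solve 1 (λ w → w :* con ½ :+ w :* con ½ := w) refl (width q n)
  where open +-*-Solver

module _ {q} (0<q : 0ℚ ℚ.< q) where

  0<width : ∀ n → 0ℚ ℚ.< width q n
  0<width zero    = 0<q
  0<width (suc n) = 0<p*½ (0<width n)

  -- This is n+1 ≤ 2^n; the linear bound is enough for the widths to vanish by the Archimedean
  -- property.
  width*suc≤ : ∀ n → width q n ℚ.* fromℕ (suc n) ℚ.≤ q
  width*suc≤ zero    = ℚₚ.≤-reflexive (ℚₚ.*-identityʳ q)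
  width*suc≤ (suc n) = ℚₚ.≤-trans (≤-by (ℚₚ.*-monoˡ-≤-nonNeg w {{ℚ.nonNegative (ℚₚ.<⇒≤ (0<p*½ (0<width n)))}} (fromℕ-mono-≤ {0} {n} z≤n)) eq)
    (width*suc≤ n)
    where
    open +-*-Solver
    w : ℚ
    w = width q n ℚ.* ½
    eq : width q n ℚ.* fromℕ (suc n) ℚ.- w ℚ.* fromℕ (suc (suc n)) ≡ w ℚ.* fromℕ n ℚ.- w ℚ.* fromℕ 0
    eq = trans (cong₂ (λ s t → width q n ℚ.* s ℚ.- w ℚ.* t) (fromℕ-homo-+ 1 n) (fromℕ-homo-+ 2 n))
      (solve 2 (λ v n → v :* (con (fromℕ 1) :+ n) :- v :* con ½ :* (con (fromℕ 2) :+ n) := v :* con ½ :* n :- v :* con ½ :* con (fromℕ 0))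
        refl (width q n) (fromℕ n))

  width-vanishes : ∀ {ε} → 0ℚ ℚ.< ε → ∃[ n ] width q n ℚ.< ε
  width-vanishes {ε} 0<ε = n , ℚₚ.*-cancelʳ-<-nonNeg (fromℕ (suc n)) (begin-strict
    width q n ℚ.* fromℕ (suc n)   ≤⟨ width*suc≤ n ⟩
    q                             ≡⟨ ℚₚ.*-identityʳ q ⟨
    q ℚ.* 1ℚ                      ≡⟨ cong (q ℚ.*_) (ℚₚ.*-inverseˡ ε) ⟨
    q ℚ.* (ℚ.1/ ε ℚ.* ε)          ≡⟨ ℚₚ.*-assoc q (ℚ.1/ ε) ε ⟨
    q ℚ.* ℚ.1/ ε ℚ.* ε            ≤⟨ ℚₚ.*-monoʳ-≤-nonNeg ε {{ℚₚ.pos⇒nonNeg ε}} (proj₂ (≤fromℕ (q ℚ.* ℚ.1/ ε))) ⟩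
    fromℕ n ℚ.* ε                 <⟨ ℚₚ.*-monoˡ-<-pos ε (fromℕ-mono-< (ℕₚ.n<1+n n)) ⟩
    fromℕ (suc n) ℚ.* ε           ≡⟨ ℚₚ.*-comm (fromℕ (suc n)) ε ⟩
    ε ℚ.* fromℕ (suc n)           ∎)
    where
    open ℚₚ.≤-Reasoning
    instance
      ε-pos : ℚ.Positive ε
      ε-pos = ℚ.positive 0<ε
      ε-nonZero : ℚ.NonZero ε
      ε-nonZero = ℚₚ.pos⇒nonZero ε
    n : ℕ
    n = proj₁ (≤fromℕ (q ℚ.* ℚ.1/ ε))

module NestedIntervals {q} (0<q : 0ℚ ℚ.< q) (a : ℕ → ℚ)
  (steps : ∀ n → a n ℚ.≤ a (suc n) × a (suc n) ℚ.+ width q (suc n) ℚ.≤ a n ℚ.+ width q n) where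

  nested′ : ∀ {m n} → m ℕ.≤′ n → a m ℚ.≤ a n × a n ℚ.+ width q n ℚ.≤ a m ℚ.+ width q m
  nested′ ℕ.≤′-refl         = ℚₚ.≤-refl , ℚₚ.≤-refl
  nested′ (ℕ.≤′-step {n} m≤n) = let l , r = nested′ m≤n; l′ , r′ = steps n in ℚₚ.≤-trans l l′ , ℚₚ.≤-trans r′ r

  nested : ∀ {m n} → m ℕ.≤ n → a m ℚ.≤ a n × a n ℚ.≤ a m ℚ.+ width q m
  nested {m} {n} m≤n = let l , r = nested′ (ℕₚ.≤⇒≤′ m≤n) in l , ℚₚ.≤-trans (p≤p+ε (0<width 0<q n)) r

  ∣-∣≤ : ∀ {p r b w} → b ℚ.≤ p → p ℚ.≤ b ℚ.+ w → b ℚ.≤ r → r ℚ.≤ b ℚ.+ w → ℚ.∣ p ℚ.- r ∣ ℚ.≤ w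
  ∣-∣≤ {p} {r} {b} {w} b≤p p≤ b≤r r≤ = ∣p∣≤
    (≤-by (ℚₚ.+-mono-≤ p≤ b≤r) (solve 4 (λ p r b w → w :- (p :- r) := b :+ w :+ r :- (p :+ b)) refl p r b w))
    (≤-by (ℚₚ.+-mono-≤ r≤ b≤p) (solve 4 (λ p r b w → w :- :- (p :- r) := b :+ w :+ p :- (r :+ b)) refl p r b w))
    where open +-*-Solver

  point : ℝ
  point .seq = a
  point .cauchy {ε} 0<ε =
    let M , w<ε = width-vanishes 0<q 0<ε
    in M , λ M≤m M≤n → let b≤p , p≤ = nested M≤m; b≤r , r≤ = nested M≤n in
         ℚₚ.≤-<-trans (∣-∣≤ b≤p p≤ b≤r r≤) w<ε

  near-left : ∀ n → ∣ fromℚ (a n) - point ∣ ≤ fromℚ (width q n)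
  near-left n 0<ε = n , λ n≤m → let b≤r , r≤ = nested n≤m in
    ℚₚ.≤-trans (∣-∣≤ ℚₚ.≤-refl (p≤p+ε (0<width 0<q n)) b≤r r≤) (p≤p+ε 0<ε)

  near-right : ∀ n → ∣ fromℚ (a n ℚ.+ width q n) - point ∣ ≤ fromℚ (width q n)
  near-right n 0<ε = n , λ n≤m → let b≤r , r≤ = nested n≤m in
    ℚₚ.≤-trans (∣-∣≤ (p≤p+ε (0<width 0<q n)) ℚₚ.≤-refl b≤r r≤) (p≤p+ε 0<ε)

≤width⇒≤0 : ∀ {q} → 0ℚ ℚ.< q → ∀ d → (∀ n → d ≤ fromℚ (width q n)) → d ≤ 0ℝ
≤width⇒≤0 {q} 0<q d h {ε} 0<ε = let n , w<ε = width-vanishes 0<q (0<p*½ 0<ε) in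
  eventually-map (λ d≤ → ℚₚ.≤-trans d≤ (≤-by (ℚₚ.<⇒≤ w<ε)
      (solve 2 (λ w e → con 0ℚ :+ e :- (w :+ e :* con ½) := e :* con ½ :- w) refl (width q n) ε)))
    (h n (0<p*½ 0<ε))
  where open +-*-Solver

0<fromℚ : ∀ {q} → 0ℚ ℚ.< q → 0ℝ < fromℚ q
0<fromℚ 0<q q≤0 = ℚₚ.<-irrefl refl (ℚₚ.<-≤-trans 0<q (fromℚ-cancel-≤ q≤0))

-- The lists of index pairs counted by R.

module FilteredPairs {P : Pred (ℕ × ℕ) 0ℓ} (P? : Decidable P) (N : ℕ) where

  private
    square = cartesianProduct (upTo N) (upTo N)

  ps! : Unique (filter P? square)
  ps! = Unique.filter⁺ P? (Unique.cartesianProduct⁺ (Unique.upTo⁺ N) (Unique.upTo⁺ N))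

  close : ∀ {p} → p ∈ filter P? square → (proj₁ p ℕ.< N × proj₂ p ℕ.< N) × P p
  close p∈ =
    let p∈square , Pp = ∈-filter⁻ P? {xs = square} p∈
        i∈ , j∈       = ∈-cartesianProduct⁻ (upTo N) (upTo N) p∈square
    in (∈-upTo⁻ i∈ , ∈-upTo⁻ j∈) , Pp

  length≤ : ∀ {ps} → Unique ps → (∀ {p} → p ∈ ps → (proj₁ p ℕ.< N × proj₂ p ℕ.< N) × P p) →
    length ps ℕ.≤ length (filter P? square)
  length≤ ps! h = Unique-⊆⇒length-≤ ps! λ p∈ → let (i<N , j<N) , Pp = h p∈ in
    ∈-filter⁺ P? (∈-cartesianProduct⁺ (∈-upTo⁺ i<N) (∈-upTo⁺ j<N)) Pp

-- Distance to the nearest integer.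

module PairCorrelations (em : ExcludedMiddle 0ℓ) where

  open Classical em
  open Sort ≤-decTotalOrder using (sort-↭; sort-↗)

  <⇒≤ : ∀ x y → x < y → x ≤ y
  <⇒≤ x y x<y with ≤-total x y
  ... | inj₁ x≤y = x≤y
  ... | inj₂ y≤x = contradiction (λ {ε} → y≤x {ε}) x<y

  ≮⇒≥ : ∀ x y → ¬ x < y → y ≤ x
  ≮⇒≥ x y ¬x<y {ε} = decidable-stable {A = y ≤ x} em ¬x<y {ε}

  -- Opaque, since comparing two norms would otherwise unfold the search for
  -- the nearest integer.
  opaque

    norm : ℝ → ℝ
    norm = ‖_‖

    norm≤∣∣ : ∀ y → norm y ≤ ∣ y ∣
    norm≤∣∣ y = ≤-trans {norm y} {∣ y - 0ℝ ∣} {∣ y ∣} (proj₂ (nearestInteger y) (+ 0))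
      (pointwise-≤ ∣ y - 0ℝ ∣ ∣ y ∣ λ n → ℚₚ.≤-reflexive (cong ℚ.∣_∣ (ℚₚ.+-identityʳ (seq y n))))

    norm-self : ∀ x → norm (x - x) ≤ 0ℝ
    norm-self x = ≤-trans {norm (x - x)} {∣ x - x ∣} {0ℝ} (norm≤∣∣ (x - x))
      (pointwise-≤ ∣ x - x ∣ 0ℝ λ n → ℚₚ.≤-reflexive (cong ℚ.∣_∣ (ℚₚ.+-inverseʳ (seq x n))))

    -- The sum of the integers nearest to `b - a` and `c - b` competes for `c - a`, and its error is
    -- at most the sum of the two errors.
    norm≤0-trans : ∀ a b c → norm (b - a) ≤ 0ℝ → norm (c - b) ≤ 0ℝ → norm (c - a) ≤ 0ℝ
    norm≤0-trans a b c b~a c~b = ≤-trans {norm (c - a)} {∣ (c - a) - fromInt (z ℤ.+ w) ∣} {0ℝ}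
      (proj₂ (nearestInteger (c - a)) (z ℤ.+ w)) nearby
      where
      z w : ℤ.ℤ
      z = proj₁ (nearestInteger (b - a))
      w = proj₁ (nearestInteger (c - b))
      nearby : ∣ (c - a) - fromInt (z ℤ.+ w) ∣ ≤ 0ℝ
      nearby {ε} 0<ε = eventually-map
        (λ {n} (h₁ , h₂) → bound (seq a n) (seq b n) (seq c n) h₁ h₂) (b~a (0<p*½ 0<ε) and c~b (0<p*½ 0<ε))
        where
        open +-*-Solver
        bound : ∀ a b c → ℚ.∣ b ℚ.- a ℚ.- fromℤ z ∣ ℚ.≤ 0ℚ ℚ.+ ε ℚ.* ½ → ℚ.∣ c ℚ.- b ℚ.- fromℤ w ∣ ℚ.≤ 0ℚ ℚ.+ ε ℚ.* ½ →
          ℚ.∣ c ℚ.- a ℚ.- fromℤ (z ℤ.+ w) ∣ ℚ.≤ 0ℚ ℚ.+ ε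
        bound a b c h₁ h₂ = subst₂ ℚ._≤_ (cong ℚ.∣_∣ rearrange)
          (solve 1 (λ e → con 0ℚ :+ e :* con ½ :+ (con 0ℚ :+ e :* con ½) := con 0ℚ :+ e) refl ε)
          (ℚₚ.≤-trans (ℚₚ.∣p+q∣≤∣p∣+∣q∣ (b ℚ.- a ℚ.- fromℤ z) (c ℚ.- b ℚ.- fromℤ w)) (ℚₚ.+-mono-≤ h₁ h₂))
          where
          rearrange : (b ℚ.- a ℚ.- fromℤ z) ℚ.+ (c ℚ.- b ℚ.- fromℤ w) ≡ c ℚ.- a ℚ.- fromℤ (z ℤ.+ w)
          rearrange = trans
            (solve 5 (λ a b c z w → (b :- a :- z) :+ (c :- b :- w) := c :- a :- (z :+ w)) refl a b c (fromℤ z) (fromℤ w))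
            (cong (λ t → c ℚ.- a ℚ.- t) (sym (fromℤ-homo-+ z w)))

  -- Spikes, and the jumps they cause in the pair counts.

  module _ (x : ℕ → ℝ) where

    Close : ℝ → (N : ℕ) → .{{NonZero N}} → ℕ × ℕ → Set
    Close s N (i , j) = (i ℕ.< N × j ℕ.< N) × i ≢ j × norm (x i - x j) ≤ s ÷ N

    opaque
      unfolding norm

      count : ℝ≥0 → (N : ℕ) → .{{NonZero N}} → ℕ
      count = R x

      count≡R : ∀ s N .{{_ : NonZero N}} → count s N ≡ R x s N
      count≡R s N = refl

      closePairs : ∀ s N .{{_ : NonZero N}} →
        ∃[ ps ] Unique ps × (∀ {p} → p ∈ ps → Close (proj₁ s) N p) × length ps ≡ count s N
      closePairs s N = _ , ps! , close , refl
        where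
        open FilteredPairs {λ (i , j) → i ≢ j × ‖ x i - x j ‖ ≤ proj₁ s ÷ N} (λ _ → em) N

      length≤count : ∀ s N .{{_ : NonZero N}} {ps} → Unique ps → (∀ {p} → p ∈ ps → Close (proj₁ s) N p) → length ps ℕ.≤ count s N
      length≤count s N = FilteredPairs.length≤ {λ (i , j) → i ≢ j × ‖ x i - x j ‖ ≤ proj₁ s ÷ N} (λ _ → em) N

      -- In the application `zs` is the first point, which closes the circle. It has to be arbitrary
      -- because it stays fixed while the recursion moves down the list.
      gap∈gapLengths : ∀ is zs {p} → p ∈ adjacentPairs is →
        norm (x (proj₁ p) - x (proj₂ p)) ∈ zipWith (λ y y′ → ‖ y′ - y ‖) (map x is) (drop 1 (map x is) ++ zs)
      gap∈gapLengths (_ ∷ _ ∷ is) zs (here refl) = here refl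
      gap∈gapLengths (_ ∷ j ∷ is) zs (there p∈)  = there (gap∈gapLengths (j ∷ is) zs p∈)

    Spike : ℕ → ℕ → ℝ → Set
    Spike A N d = ∃[ ps ] Unique ps × (∀ {p} → p ∈ ps → (proj₁ p ℕ.< N × proj₂ p ℕ.< N) × norm (x (proj₁ p) - x (proj₂ p)) ≃ d) × N ℕ.< length ps ℕ.* A

    Within : ℝ → ℝ → (N : ℕ) → .{{NonZero N}} → ℝ → Set
    Within a b N d = ¬ d ≤ a ÷ N × d ≤ b ÷ N

    -- A `Spike` does not ask for distinct indices; they are distinct because the common distance is
    -- positive.
    off-diagonal : ∀ i j r → 0ℝ ≤ r → ¬ norm (x i - x j) ≤ r → i ≢ j
    off-diagonal i .i r 0≤r d≰r refl = d≰r (≤-trans {norm (x i - x i)} {0ℝ} {r} (norm-self (x i)) 0≤r)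

    -- The pairs counted at `a` and those of the spike are disjoint, since the latter lie beyond
    -- a/N, and all of them are counted at `b`. The spike adds more than N/A.
    spike⇒jump : ∀ {A} (a b : ℝ≥0) N .{{_ : NonZero N}} {d} → 0ℝ ≤ proj₁ a ÷ N → proj₁ a ÷ N ≤ proj₁ b ÷ N →
      Spike A N d → Within (proj₁ a) (proj₁ b) N d → count a N ℕ.* A ℕ.+ N ℕ.≤ count b N ℕ.* A
    spike⇒jump {A} a b N {d} 0≤a a≤b spike within = subst (λ r → r ℕ.* A ℕ.+ N ℕ.≤ count b N ℕ.* A) eq (ℕₚ.≤-trans sizes
      (ℕₚ.*-monoˡ-≤ A (length≤count b N (Unique.++⁺ as! ps! disjoint) close-b)))
      where
      open ℕₚ.≤-Reasoning
      as      = proj₁ (closePairs a N)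
      as!     = proj₁ (proj₂ (closePairs a N))
      close-a = proj₁ (proj₂ (proj₂ (closePairs a N)))
      eq      = proj₂ (proj₂ (proj₂ (closePairs a N)))
      ps      = proj₁ spike
      ps!     = proj₁ (proj₂ spike)
      at-d    = proj₁ (proj₂ (proj₂ spike))
      N<      = proj₂ (proj₂ (proj₂ spike))
      not-a : ∀ {p} → p ∈ ps → ¬ norm (x (proj₁ p) - x (proj₂ p)) ≤ proj₁ a ÷ N
      not-a {p} p∈ d≤a = proj₁ within (≤-trans {d} {norm (x (proj₁ p) - x (proj₂ p))} {proj₁ a ÷ N} (proj₂ (proj₂ (at-d p∈))) d≤a)
      sizes : length as ℕ.* A ℕ.+ N ℕ.≤ length (as ++ ps) ℕ.* A
      sizes = begin
        length as ℕ.* A ℕ.+ N               ≤⟨ ℕₚ.+-monoʳ-≤ (length as ℕ.* A) (ℕₚ.<⇒≤ N<) ⟩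
        length as ℕ.* A ℕ.+ length ps ℕ.* A ≡⟨ ℕₚ.*-distribʳ-+ A (length as) (length ps) ⟨
        (length as ℕ.+ length ps) ℕ.* A     ≡⟨ cong (ℕ._* A) (length-++ as) ⟨
        length (as ++ ps) ℕ.* A             ∎
      disjoint : ∀ {p} → ¬ (p ∈ as × p ∈ ps)
      disjoint both = not-a (proj₂ both) (proj₂ (proj₂ (close-a (proj₁ both))))
      close-b : ∀ {p} → p ∈ as ++ ps → Close (proj₁ b) N p
      close-b {p} p∈ = [ from-as , from-ps ] (∈-++⁻ as p∈)
        where
        from-as : p ∈ as → Close (proj₁ b) N p
        from-as p∈as = proj₁ (close-a p∈as) , proj₁ (proj₂ (close-a p∈as)) ,
          ≤-trans {norm (x (proj₁ p) - x (proj₂ p))} {proj₁ a ÷ N} {proj₁ b ÷ N} (proj₂ (proj₂ (close-a p∈as))) a≤b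
        from-ps : p ∈ ps → Close (proj₁ b) N p
        from-ps p∈ps = proj₁ (at-d p∈ps)
          , off-diagonal (proj₁ p) (proj₂ p) (proj₁ a ÷ N) 0≤a (not-a p∈ps)
          , ≤-trans {norm (x (proj₁ p) - x (proj₂ p))} {d} {proj₁ b ÷ N} (proj₁ (proj₂ (at-d p∈ps))) (proj₂ within)

    -- The gaps of sorted points sum to at most 1.

    module _ (x<1 : ∀ i → x i < 1ℝ) (q : ℚ) where

      private
        Wide? : Decidable (λ p → fromℚ q ≤ norm (x (proj₁ p) - x (proj₂ p)))
        Wide? _ = em

      -- Induction from the right end, where the bound is x < 1. Each wide gap moves the bound down
      -- by `q`, as the norm is at most the actual difference of the sorted neighbours.
      wide-gaps : ∀ i is → Linked (λ i j → x i ≤ x j) (i ∷ is) →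
        x i ≤ fromℚ (1ℚ ℚ.- fromℕ (length (filter Wide? (adjacentPairs (i ∷ is)))) ℚ.* q)
      wide-gaps i [] _ = ≤-trans {x i} {1ℝ} {fromℚ (1ℚ ℚ.- 0ℚ ℚ.* q)} (<⇒≤ (x i) 1ℝ (x<1 i))
        (pointwise-≤ 1ℝ (fromℚ (1ℚ ℚ.- 0ℚ ℚ.* q)) λ _ → ℚₚ.≤-reflexive (solve 1 (λ q → con 1ℚ := con 1ℚ :- con 0ℚ :* q) refl q))
        where open +-*-Solver
      wide-gaps i (j ∷ is) (i≤j ∷ sorted) with Wide? (j , i)
      ... | no _     = ≤-trans {x i} {x j} {fromℚ (1ℚ ℚ.- fromℕ (length (filter Wide? (adjacentPairs (j ∷ is)))) ℚ.* q)}
        i≤j (wide-gaps j is sorted)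
      ... | yes wide = subst (λ t → x i ≤ fromℚ t) eq
        (≤-shift (x i) (x j) q (1ℚ ℚ.- fromℕ n ℚ.* q)
          (≤-trans {fromℚ q} {norm (x j - x i)} {∣ x j - x i ∣} wide (norm≤∣∣ (x j - x i))) i≤j (wide-gaps j is sorted))
        where
        open +-*-Solver
        n : ℕ
        n = length (filter Wide? (adjacentPairs (j ∷ is)))
        eq : 1ℚ ℚ.- fromℕ n ℚ.* q ℚ.- q ≡ 1ℚ ℚ.- fromℕ (suc n) ℚ.* q
        eq = trans (solve 2 (λ n q → con 1ℚ :- n :* q :- q := con 1ℚ :- (con 1ℚ :+ n) :* q) refl (fromℕ n) q)
          (cong (λ t → 1ℚ ℚ.- t ℚ.* q) (sym (fromℕ-homo-+ 1 n)))

      few-wide-gaps : (∀ i → 0ℝ ≤ x i) → ∀ {is ps} → Linked (λ i j → x i ≤ x j) is →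
        Unique ps → (∀ {p} → p ∈ ps → p ∈ adjacentPairs is × fromℚ q ≤ norm (x (proj₁ p) - x (proj₂ p))) → 0ℚ ℚ.≤ q → fromℕ (length ps) ℚ.* q ℚ.≤ 1ℚ
      few-wide-gaps 0≤x {[]} {[]} _ _ _ _ = ℚₚ.≤-trans (ℚₚ.≤-reflexive (ℚₚ.*-zeroˡ q)) (ℚₚ.nonNegative⁻¹ 1ℚ)
      few-wide-gaps 0≤x {[]} {_ ∷ _} _ _ wide _ with wide (here refl)
      ... | () , _
      few-wide-gaps 0≤x {i ∷ is} {ps} sorted ps! wide 0≤q = ℚₚ.≤-trans
        (ℚₚ.*-monoʳ-≤-nonNeg q {{ℚ.nonNegative 0≤q}} (fromℕ-mono-≤ (Unique-⊆⇒length-≤ ps!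
          λ p∈ → let p∈adj , w = wide p∈ in ∈-filter⁺ Wide? p∈adj (λ {ε} → w {ε}))))
        (≤-by (fromℚ-cancel-≤ {0ℚ} {1ℚ ℚ.- m} (≤-trans {0ℝ} {x i} {fromℚ (1ℚ ℚ.- m)} (0≤x i) (wide-gaps i is sorted)))
          (solve 1 (λ m → con 1ℚ :- m := con 1ℚ :- m :- con 0ℚ) refl m))
        where
        open +-*-Solver
        m : ℚ
        m = fromℕ (length (filter Wide? (adjacentPairs (i ∷ is)))) ℚ.* q

    -- Carries `NonZero N` along because `InfinitelyMany` ranges over all naturals, while `Within`
    -- divides by N.
    SpikeAt : ℕ → ℚ → ℚ → ℕ → Set
    SpikeAt A a b N = Σ (NonZero N) λ N≢0 → ∃[ d ] Spike A N d × Within (fromℚ a) (fromℚ b) N {{N≢0}} d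

    -- Infinite pigeonhole: if the left part is not hit infinitely often, it is not hit beyond some
    -- `last`, and every later spike then fails `d ≤ c ÷ N`. This is the lower bound that the right
    -- half-open part demands.
    split : ∀ {A a b} c → InfinitelyMany (SpikeAt A a b) →
      InfinitelyMany (SpikeAt A a c) ⊎ InfinitelyMany (SpikeAt A c b)
    split {A} {a} {b} c often = compare em
      where
      compare : Dec (InfinitelyMany (SpikeAt A a c)) → InfinitelyMany (SpikeAt A a c) ⊎ InfinitelyMany (SpikeAt A c b)
      compare (yes left) = inj₁ left
      compare (no ¬left) = inj₂ λ M → right M (often (M ℕ.⊔ proj₁ last))
        where
        last : ∃[ M ] ∀ N → M ℕ.≤ N → ¬ SpikeAt A a c N
        last = decidable-stable em λ ¬last → ¬left λ M → decidable-stable em λ ¬next →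
          ¬last (M , λ N M≤N s → ¬next (N , M≤N , s))
        right : ∀ M → (∃[ N ] M ℕ.⊔ proj₁ last ℕ.≤ N × SpikeAt A a b N) → ∃[ N ] M ℕ.≤ N × SpikeAt A c b N
        right M (N , M≤N , N≢0 , d , spiky , d≰a , d≤b) =
          N , ℕₚ.m⊔n≤o⇒m≤o M (proj₁ last) M≤N , N≢0 , d , spiky ,
          (λ d≤c → proj₂ last N (ℕₚ.m⊔n≤o⇒n≤o M (proj₁ last) M≤N) (N≢0 , d , spiky , d≰a , d≤c)) , d≤b

    -- A spike for each large N with few gap lengths.

    module _ (bounds : ∀ i → 0ℝ ≤ x i × x i < 1ℝ) where

      private

        Z : ℕ → ℕ → Set
        Z i j = norm (x j - x i) ≤ 0ℝ

        Z-trans : Transitive Z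
        Z-trans {i} {j} {k} = norm≤0-trans (x i) (x j) (x k)

        _at_ : ℕ × ℕ → ℝ → Set
        p at d = norm (x (proj₁ p) - x (proj₂ p)) ≃ d

        at? : ∀ d → Decidable (_at d)
        at? _ _ = em

      open Runs {Z = Z} (λ _ _ → em) (λ {i} {j} {k} → Z-trans {i} {j} {k})

      -- Lifts the sorted points to sorted indices: R counts pairs of indices, and only these tell
      -- repeated points apart.
      sorting : ∀ N → ∃[ is ] sort (map x (upTo N)) ≡ map x is × upTo N ↭ is
      sorting N = Perm.↭-map-inv x (↭-sym (sort-↭ (map x (upTo N))))

      module SortedPoints (N : ℕ) .{{_ : NonZero N}} (is : List ℕ) (sort≡ : sort (map x (upTo N)) ≡ map x is) (upTo↭is : upTo N ↭ is) where

        is! : Unique is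
        is! = PermSetoid.Unique-resp-↭ (setoid ℕ) (↭⇒↭ₛ upTo↭is) (Unique.upTo⁺ N)

        length-is : length is ≡ N
        length-is = trans (sym (Perm.↭-length upTo↭is)) (length-upTo N)

        ∈is⇒<N : ∀ {i} → i ∈ is → i ℕ.< N
        ∈is⇒<N i∈ = ∈-upTo⁻ (Perm.∈-resp-↭ (↭-sym upTo↭is) i∈)

        is↗ : Linked (λ i j → x i ≤ x j) is
        is↗ = Linked.map⁻ (subst (Linked _≤_) sort≡ (sort-↗ (map x (upTo N))))

        relatedPairs≤count : length (relatedPairs is) ℕ.≤ count 0ₛ N
        relatedPairs≤count = length≤count 0ₛ N (relatedPairs! is!) λ {p} p∈ →
          let (j∈ , i∈) , j≢i , ≤0 = ∈-relatedPairs⁻ is! p∈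
          in (∈is⇒<N j∈ , ∈is⇒<N i∈) , j≢i , ≤-trans {norm (x (proj₁ p) - x (proj₂ p))} {0ℝ} {0ℝ ÷ N} ≤0 (0≤0÷ N)

        -- The threshold h = C+1 is the least for which h N exceeds the at most C N coincidences by
        -- N.
        many-breaks : ∀ C → count 0ₛ N ℕ.≤ C ℕ.* N → N ℕ.≤ suc C ℕ.* suc C ℕ.* suc (length (breaks is))
        many-breaks C few = ℕₚ.+-cancelʳ-≤ (C ℕ.* N) N _ (begin
          N ℕ.+ C ℕ.* N                                                       ≡⟨ cong (suc C ℕ.*_) length-is ⟨
          suc C ℕ.* length is                                                 ≤⟨ length≤breaks C is ⟩
          length (relatedPairs is) ℕ.+ suc C ℕ.* suc C ℕ.* suc (length (breaks is))  ≤⟨ ℕₚ.+-monoˡ-≤ _ (ℕₚ.≤-trans relatedPairs≤count few) ⟩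
          C ℕ.* N ℕ.+ suc C ℕ.* suc C ℕ.* suc (length (breaks is))            ≡⟨ ℕₚ.+-comm (C ℕ.* N) _ ⟩
          suc C ℕ.* suc C ℕ.* suc (length (breaks is)) ℕ.+ C ℕ.* N            ∎)
          where open ℕₚ.≤-Reasoning

        lengths : List ℝ
        lengths = deduplicate _≟_ (gapLengths (map x (upTo N)))

        ∈breaks⁻ : ∀ {p} → p ∈ breaks is → p ∈ adjacentPairs is × ¬ norm (x (proj₁ p) - x (proj₂ p)) ≤ 0ℝ
        ∈breaks⁻ p∈ = ∈-filter⁻ _ {xs = adjacentPairs is} p∈

        -- `deduplicate` keeps one representative of each class under `≃`, so the gap itself may
        -- have been dropped in favour of an equal real.
        gap-length : ∀ {p} → p ∈ adjacentPairs is → ∃[ d ] d ∈ lengths × p at d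
        gap-length {p} p∈ = find (Any.deduplicate⁺ _≟_ (λ {d} {e} → resp {d} {e}) (Any.map (λ {d} → same {d}) gap∈))
          where
          gap : ℝ
          gap = norm (x (proj₁ p) - x (proj₂ p))
          gap∈ : gap ∈ gapLengths (map x (upTo N))
          gap∈ = subst (λ ys → gap ∈ zipWith (λ y y′ → ‖ y′ - y ‖) ys (drop 1 ys ++ take 1 ys)) (sym sort≡)
            (gap∈gapLengths is (take 1 (map x is)) p∈)
          same : ∀ {d} → gap ≡ d → gap ≃ d
          same refl = ≤-refl {gap} , ≤-refl {gap}
          resp : ∀ {d e} → e ≃ d → gap ≃ d → gap ≃ e
          resp {d} {e} (e≤d , d≤e) (g≤d , d≤g) = ≤-trans {gap} {d} {e} g≤d d≤e , ≤-trans {e} {d} {gap} e≤d d≤g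

        -- Otherwise the B breaks satisfy B A ≤ k N, and N ≤ (C+1)²(B+1) multiplied by 2(k+1) gives
        -- 2(k+1)N ≤ A + B A ≤ (k+1)N. The factor 2 in A makes this absurd, and `A ≤ N` absorbs the
        -- 1 in B+1.
        frequent-length : ∀ {k C} → length lengths ℕ.≤ k → count 0ₛ N ℕ.≤ C ℕ.* N →
          let A = 2 ℕ.* suc k ℕ.* (suc C ℕ.* suc C) in A ℕ.≤ N →
          ∃[ d ] N ℕ.< length (filter (at? d) (breaks is)) ℕ.* A
        frequent-length {k} {C} k-lengths few A≤N = decidable-stable em λ ¬frequent → contradiction (impossible ¬frequent)
            (ℕₚ.<⇒≱ (ℕₚ.m<m+n (suc k ℕ.* N) {suc k ℕ.* N} (ℕ.>-nonZero⁻¹ _ {{ℕₚ.m*n≢0 (suc k) N}})))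
          where
          open ℕₚ.≤-Reasoning
          H² A B : ℕ
          H² = suc C ℕ.* suc C
          A  = 2 ℕ.* suc k ℕ.* H²
          B  = length (breaks is)
          module _ (¬frequent : ¬ (∃[ d ] N ℕ.< length (filter (at? d) (breaks is)) ℕ.* A)) where
            total : B ℕ.* A ℕ.≤ length lengths ℕ.* N
            total = pigeonhole at? A N lengths (breaks is) (λ p∈ → gap-length (proj₁ (∈breaks⁻ p∈)))
              (λ {d} _ → ℕₚ.≮⇒≥ λ N< → ¬frequent (d , N<))
            impossible : suc k ℕ.* N ℕ.+ suc k ℕ.* N ℕ.≤ suc k ℕ.* N
            impossible = begin
              suc k ℕ.* N ℕ.+ suc k ℕ.* N       ≡⟨ eq₁ (suc k) N ⟩
              2 ℕ.* suc k ℕ.* N                 ≤⟨ ℕₚ.*-monoʳ-≤ (2 ℕ.* suc k) (many-breaks C few) ⟩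
              2 ℕ.* suc k ℕ.* (H² ℕ.* suc B)    ≡⟨ eq₂ (2 ℕ.* suc k) H² B ⟩
              A ℕ.+ B ℕ.* A                     ≤⟨ ℕₚ.+-mono-≤ A≤N (ℕₚ.≤-trans total (ℕₚ.*-monoˡ-≤ N k-lengths)) ⟩
              suc k ℕ.* N                       ∎
              where
              eq₁ : ∀ k n → k ℕ.* n ℕ.+ k ℕ.* n ≡ 2 ℕ.* k ℕ.* n
              eq₁ = solve-∀
              eq₂ : ∀ k h b → k ℕ.* (h ℕ.* (1 ℕ.+ b)) ≡ k ℕ.* h ℕ.+ b ℕ.* (k ℕ.* h)
              eq₂ = solve-∀

        module _ {A d} (frequent : N ℕ.< length (filter (at? d) (breaks is)) ℕ.* A) where

          private
            ps : List (ℕ × ℕ)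
            ps = filter (at? d) (breaks is)

            ps! : Unique ps
            ps! = Unique.filter⁺ (at? d) (Unique.filter⁺ _ (adjacentPairs! is!))

            ∈ps⁻ : ∀ {p} → p ∈ ps → p ∈ breaks is × p at d
            ∈ps⁻ p∈ = ∈-filter⁻ (at? d) {xs = breaks is} p∈

            nonempty : ∃[ p ] p ∈ ps
            nonempty = inhabitant ps frequent
              where
              inhabitant : ∀ ps → N ℕ.< length ps ℕ.* A → ∃[ p ] p ∈ ps
              inhabitant (p ∷ _) _ = p , here refl

          spike : Spike A N d
          spike = ps , ps! , (λ p∈ → let p∈breaks , p-at = ∈ps⁻ p∈
                                         j∈ , i∈         = ∈-adjacentPairs⁻ is (proj₁ (∈breaks⁻ p∈breaks))
                                     in (∈is⇒<N j∈ , ∈is⇒<N i∈) , p-at) , frequent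

          spike-within : Within 0ℝ (fromNat A) N d
          spike-within = positive , small
            where
            positive : ¬ d ≤ 0ℝ ÷ N
            positive d≤0 = proj₂ (∈breaks⁻ (proj₁ (∈ps⁻ p∈)))
              (≤-trans {gap} {d} {0ℝ} (proj₁ (proj₂ (∈ps⁻ p∈))) (≤-trans {d} {0ℝ ÷ N} {0ℝ} d≤0 (0÷≤0 N)))
              where
              p : ℕ × ℕ
              p = proj₁ nonempty
              p∈ : p ∈ ps
              p∈ = proj₂ nonempty
              gap : ℝ
              gap = norm (x (proj₁ p) - x (proj₂ p))
            q : ℚ
            q = fromℕ A ℚ.* 1/ N
            instance
              1/N-positive : ℚ.Positive (1/ N)
              1/N-positive = ℚ.positive (1/-pos N)
            0≤q : 0ℚ ℚ.≤ q
            0≤q = subst (ℚ._≤ q) (ℚₚ.*-zeroˡ (1/ N)) (ℚₚ.*-monoʳ-≤-nonNeg (1/ N) {{ℚₚ.pos⇒nonNeg (1/ N)}} (fromℕ-mono-≤ {0} {A} z≤n))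
            -- If d were at least A/N, the spike would consist of more than N/A disjoint gaps of
            -- that size, too many for the unit interval.
            1<nq : 1ℚ ℚ.< fromℕ (length ps) ℚ.* q
            1<nq = begin-strict
              1ℚ                                      ≡⟨ n*1/n≡1 N ⟨
              fromℕ N ℚ.* 1/ N                        <⟨ ℚₚ.*-monoˡ-<-pos (1/ N) (fromℕ-mono-< frequent) ⟩
              fromℕ (length ps ℕ.* A) ℚ.* 1/ N        ≡⟨ cong (ℚ._* 1/ N) (fromℕ-homo-* (length ps) A) ⟩
              fromℕ (length ps) ℚ.* fromℕ A ℚ.* 1/ N  ≡⟨ ℚₚ.*-assoc (fromℕ (length ps)) (fromℕ A) (1/ N) ⟩
              fromℕ (length ps) ℚ.* q                 ∎
              where open ℚₚ.≤-Reasoning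
            compare : d ≤ fromNat A ÷ N ⊎ fromNat A ÷ N ≤ d → d ≤ fromNat A ÷ N
            compare (inj₁ d≤q) = d≤q
            compare (inj₂ q≤d) = contradiction
              (few-wide-gaps (λ i → proj₂ (bounds i)) q (λ i → proj₁ (bounds i)) {is} {ps} is↗ ps!
                (λ {p} p∈ → proj₁ (∈breaks⁻ (proj₁ (∈ps⁻ p∈)))
                          , ≤-trans {fromℚ q} {d} {norm (x (proj₁ p) - x (proj₂ p))} q≤d (proj₂ (proj₂ (∈ps⁻ p∈))))
                0≤q)
              (λ nq≤1 → ℚₚ.<-irrefl refl (ℚₚ.<-≤-trans 1<nq nq≤1))
            small : d ≤ fromNat A ÷ N
            small = compare (≤-total d (fromNat A ÷ N))

      spike-exists : ∀ {k C} N .{{_ : NonZero N}} → distinctGapLengths x N ℕ.≤ k → count 0ₛ N ℕ.≤ C ℕ.* N →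
        let A = 2 ℕ.* suc k ℕ.* (suc C ℕ.* suc C) in A ℕ.≤ N →
        ∃[ d ] Spike A N d × Within 0ℝ (fromNat A) N d
      spike-exists {k} {C} N k-lengths few A≤N = d , spike {d = d} frequent , spike-within {d = d} frequent
        where
        open SortedPoints N (proj₁ (sorting N)) (proj₁ (proj₂ (sorting N))) (proj₂ (proj₂ (sorting N)))
        d : ℝ
        d = proj₁ (frequent-length {k} {C} k-lengths few A≤N)
        frequent : N ℕ.< length (filter (at? d) (breaks (proj₁ (sorting N)))) ℕ.* (2 ℕ.* suc k ℕ.* (suc C ℕ.* suc C))
        frequent = proj₂ (frequent-length {k} {C} k-lengths few A≤N)

    -- Consequences of the limits, and the bisection.

    module _ (f : ℝ≥0 → ℝ≥0) (pc : HasPairCorrelations f x) where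

      ratio : ℝ≥0 → (N : ℕ) → .{{NonZero N}} → ℚ
      ratio s N = fromℕ (count s N) ℚ.* 1/ N

      ratio-converges : ∀ s {e} → 0ℚ ℚ.< e →
        ∃[ M ] ∀ N .{{_ : NonZero N}} → M ℕ.≤ N → ∣ fromℚ (ratio s N) - proj₁ (f s) ∣ ≤ fromℚ e
      ratio-converges s {e} 0<e = proj₁ limit , λ N M≤N →
        subst (λ n → ∣ fromℚ (fromℕ n ℚ.* 1/ N) - proj₁ (f s) ∣ ≤ fromℚ e) (sym (count≡R s N))
          (<⇒≤ ∣ fromNat (R x s N) ÷ N - proj₁ (f s) ∣ (fromℚ e) (proj₂ limit N M≤N))
        where
        limit : ∃[ M ] ∀ N .{{_ : NonZero N}} → M ℕ.≤ N → ∣ fromNat (R x s N) ÷ N - proj₁ (f s) ∣ < fromℚ e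
        limit = pc s (fromℚ e) (0<fromℚ 0<e)

      few-coincidences : ∃[ C ] ∃[ M ] ∀ N .{{_ : NonZero N}} → M ℕ.≤ N → count 0ₛ N ℕ.≤ C ℕ.* N
      few-coincidences =
        let M , near    = ratio-converges 0ₛ (ℚₚ.positive⁻¹ 1ℚ)
            C , bounded = near⇒bounded (proj₁ (f 0ₛ))
        in C , M , λ N M≤N → ratio≤⇒≤* {b = C} N (bounded (ratio 0ₛ N) (near N M≤N))

      -- `A` is built from k and C alone, hence is the same for all N. Taking N beyond `M₀` secures
      -- the bound on coincidences, and beyond `A` the hypothesis of `spike-exists`.
      recurrent-spikes : ∀ {k} → (∀ i → 0ℝ ≤ x i × x i < 1ℝ) → InfinitelyMany (λ N → distinctGapLengths x N ℕ.≤ k) →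
        ∃[ A ] NonZero A × InfinitelyMany (SpikeAt A 0ℚ (fromℕ A))
      recurrent-spikes {k} bounds k-lengths = A , _ , λ M → recur M (k-lengths (M ℕ.⊔ (M₀ ℕ.⊔ A)))
        where
        C M₀ A : ℕ
        C  = proj₁ few-coincidences
        M₀ = proj₁ (proj₂ few-coincidences)
        A  = 2 ℕ.* suc k ℕ.* (suc C ℕ.* suc C)
        recur : ∀ M → (∃[ N ] M ℕ.⊔ (M₀ ℕ.⊔ A) ℕ.≤ N × distinctGapLengths x N ℕ.≤ k) →
          ∃[ N ] M ℕ.≤ N × SpikeAt A 0ℚ (fromℕ A) N
        recur M (N , M≤N , N-lengths) = N , ℕₚ.m⊔n≤o⇒m≤o M (M₀ ℕ.⊔ A) M≤N , N≢0 ,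
          spike-exists bounds {k} {C} N {{N≢0}} N-lengths (proj₂ (proj₂ few-coincidences) N {{N≢0}} (ℕₚ.m⊔n≤o⇒m≤o M₀ A M₀⊔A≤N)) A≤N
          where
          M₀⊔A≤N : M₀ ℕ.⊔ A ℕ.≤ N
          M₀⊔A≤N = ℕₚ.m⊔n≤o⇒n≤o M (M₀ ℕ.⊔ A) M≤N
          A≤N : A ℕ.≤ N
          A≤N = ℕₚ.m⊔n≤o⇒n≤o M₀ A M₀⊔A≤N
          N≢0 : NonZero N
          N≢0 = ℕ.>-nonZero (ℕₚ.≤-trans (s≤s z≤n) A≤N)

      module Bisection (A : ℕ) .{{_ : NonZero A}} (often : InfinitelyMany (SpikeAt A 0ℚ (fromℕ A))) where

        w : ℕ → ℚ
        w = width (fromℕ A)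

        0<A : 0ℚ ℚ.< fromℕ A
        0<A = fromℕ-mono-< (ℕ.>-nonZero⁻¹ A)

        -- The condition `0 ≤ a` makes both endpoints admissible arguments of f.
        Interval : ℕ → Set
        Interval n = ∃[ a ] 0ℚ ℚ.≤ a × InfinitelyMany (SpikeAt A a (a ℚ.+ w n))

        halve : ∀ n (i : Interval n) →
          Σ (Interval (suc n)) λ j → proj₁ i ℚ.≤ proj₁ j × proj₁ j ℚ.+ w (suc n) ℚ.≤ proj₁ i ℚ.+ w n
        halve n (a , 0≤a , i-often) = choose (split {A} {a} {a ℚ.+ w n} mid i-often)
          where
          0<w : 0ℚ ℚ.< w (suc n)
          0<w = 0<width 0<A (suc n)
          mid : ℚ
          mid = a ℚ.+ w (suc n)
          a≤mid : a ℚ.≤ mid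
          a≤mid = p≤p+ε 0<w
          end : mid ℚ.+ w (suc n) ≡ a ℚ.+ w n
          end = trans (ℚₚ.+-assoc a (w (suc n)) (w (suc n))) (cong (a ℚ.+_) (width+width (fromℕ A) n))
          choose : InfinitelyMany (SpikeAt A a mid) ⊎ InfinitelyMany (SpikeAt A mid (a ℚ.+ w n)) →
            Σ (Interval (suc n)) λ j → a ℚ.≤ proj₁ j × proj₁ j ℚ.+ w (suc n) ℚ.≤ a ℚ.+ w n
          choose (inj₁ left)  = (a , 0≤a , left) , ℚₚ.≤-refl , ℚₚ.≤-trans (p≤p+ε 0<w) (ℚₚ.≤-reflexive end)
          choose (inj₂ right) = (mid , ℚₚ.≤-trans 0≤a a≤mid , subst (λ b → InfinitelyMany (SpikeAt A mid b)) (sym end) right)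
            , a≤mid , ℚₚ.≤-reflexive end

        intervals : ∀ n → Interval n
        intervals zero    = 0ℚ , ℚₚ.≤-refl , subst (λ b → InfinitelyMany (SpikeAt A 0ℚ b)) (sym (ℚₚ.+-identityˡ (fromℕ A))) often
        intervals (suc n) = proj₁ (halve n (intervals n))

        a : ℕ → ℚ
        a n = proj₁ (intervals n)

        0≤a : ∀ n → 0ℚ ℚ.≤ a n
        0≤a n = proj₁ (proj₂ (intervals n))

        0≤b : ∀ n → 0ℚ ℚ.≤ a n ℚ.+ w n
        0≤b n = ℚₚ.≤-trans (0≤a n) (p≤p+ε (0<width 0<A n))

        open NestedIntervals 0<A a (λ n → proj₂ (halve n (intervals n)))

        s : ℝ≥0
        s = point , pointwise-≤ 0ℝ point 0≤a

        -- Chosen so that the 8e of `near⇒close` is 1/(2A), half of the jump.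
        e : ℚ
        e = 1/ A ℚ.* (½ ℚ.* ½ ℚ.* ½ ℚ.* ½)

        0<e : 0ℚ ℚ.< e
        0<e = ℚₚ.*-monoˡ-<-pos (½ ℚ.* ½ ℚ.* ½ ℚ.* ½) (1/-pos A)

        fₗ fᵣ : ℕ → ℝ
        fₗ n = proj₁ (f (rational (a n) (0≤a n)))
        fᵣ n = proj₁ (f (rational (a n ℚ.+ w n) (0≤b n)))

        -- With n fixed, the thresholds for convergence at the two endpoints are fixed too, and the
        -- interval still contains a spike for some N beyond both. There the ratios differ by at
        -- least 1/A, yet by at most 1/(2A).
        no-jump : ∀ n → ∣ fₗ n - proj₁ (f s) ∣ ≤ fromℚ e → ∣ fᵣ n - proj₁ (f s) ∣ ≤ fromℚ e → ⊥
        no-jump n near-l near-r = at-spike (proj₂ (proj₂ (intervals n)) (proj₁ Mₗ ℕ.⊔ proj₁ Mᵣ))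
          where
          l r : ℝ≥0
          l = rational (a n) (0≤a n)
          r = rational (a n ℚ.+ w n) (0≤b n)
          Mₗ : ∃[ M ] ∀ N .{{_ : NonZero N}} → M ℕ.≤ N → ∣ fromℚ (ratio l N) - fₗ n ∣ ≤ fromℚ e
          Mₗ = ratio-converges l 0<e
          Mᵣ : ∃[ M ] ∀ N .{{_ : NonZero N}} → M ℕ.≤ N → ∣ fromℚ (ratio r N) - fᵣ n ∣ ≤ fromℚ e
          Mᵣ = ratio-converges r 0<e
          at-spike : (∃[ N ] proj₁ Mₗ ℕ.⊔ proj₁ Mᵣ ℕ.≤ N × SpikeAt A (a n) (a n ℚ.+ w n) N) → ⊥
          at-spike (N , M≤N , N≢0 , d , spiky , within) =
            ℚₚ.<-irrefl refl (ℚₚ.<-≤-trans (0<p*½ (1/-pos A)) (≤-by (ℚₚ.≤-trans jump close)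
              (solve 2 (λ p v → con 0ℚ :- v :* con ½
                 := p :+ con (fromℕ 8) :* (v :* con (½ ℚ.* ½ ℚ.* ½ ℚ.* ½)) :- (p :+ v)) refl (ratio l N) (1/ A))))
            where
            open +-*-Solver
            instance
              nonZero : NonZero N
              nonZero = N≢0
            jump : ratio l N ℚ.+ 1/ A ℚ.≤ ratio r N
            jump = jump-in-ratios {m = count l N} {n = count r N} N A (spike⇒jump l r N {d} (≤-trans {0ℝ} {0ℝ ÷ N} {fromℚ (a n) ÷ N} (0≤0÷ N) (÷-mono-≤ {0ℚ} {a n} N (0≤a n)))
              (÷-mono-≤ {a n} {a n ℚ.+ w n} N (p≤p+ε (0<width 0<A n))) spiky within)
            close : ratio r N ℚ.≤ ratio l N ℚ.+ fromℕ 8 ℚ.* e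
            close = near⇒close (ratio l N) (ratio r N) (fₗ n) (fᵣ n) (proj₁ (f s)) e 0<e
              (proj₂ Mₗ N (ℕₚ.m⊔n≤o⇒m≤o (proj₁ Mₗ) (proj₁ Mᵣ) M≤N)) near-l
              (proj₂ Mᵣ N (ℕₚ.m⊔n≤o⇒n≤o (proj₁ Mₗ) (proj₁ Mᵣ) M≤N)) near-r

        discontinuous : ¬ Continuous f
        discontinuous continuous = no-jump n
          (<⇒≤ ∣ fₗ n - proj₁ (f s) ∣ (fromℚ e) (controls (rational (a n) (0≤a n)) (within ∣ fromℚ (a n) - point ∣ (near-left n))))
          (<⇒≤ ∣ fᵣ n - proj₁ (f s) ∣ (fromℚ e) (controls (rational (a n ℚ.+ w n) (0≤b n)) (within ∣ fromℚ (a n ℚ.+ w n) - point ∣ (near-right n))))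
          where
          modulus : ∃[ δ ] 0ℝ < δ × (∀ t → ∣ proj₁ t - point ∣ < δ → ∣ proj₁ (f t) - proj₁ (f s) ∣ < fromℚ e)
          modulus = continuous s (fromℚ e) (0<fromℚ 0<e)
          δ : ℝ
          δ = proj₁ modulus
          controls : ∀ t → ∣ proj₁ t - point ∣ < δ → ∣ proj₁ (f t) - proj₁ (f s) ∣ < fromℚ e
          controls = proj₂ (proj₂ modulus)
          -- The modulus is a real number; if no width were below it, it would lie below all widths
          -- and hence be at most 0.
          narrow : ∃[ n ] fromℚ (w n) < δ
          narrow = decidable-stable em λ ¬narrow → proj₁ (proj₂ modulus)
            (≤width⇒≤0 0<A δ λ n → ≮⇒≥ (fromℚ (w n)) δ λ w<δ → ¬narrow (n , w<δ))
          n : ℕ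
          n = proj₁ narrow
          within : ∀ y → y ≤ fromℚ (w n) → y < δ
          within y y≤w δ≤y = proj₂ narrow (≤-trans {δ} {y} {fromℚ (w n)} δ≤y y≤w)

  no-pair-correlations : (f : ℝ≥0 → ℝ≥0) → Continuous f → (x : ℕ → ℝ) → (∀ i → 0ℝ ≤ x i × x i < 1ℝ) →
    (∃[ k ] InfinitelyMany (λ N → distinctGapLengths x N ℕ.≤ k)) → ¬ HasPairCorrelations f x
  no-pair-correlations f continuous x bounds (k , k-lengths) pc = contradict (recurrent-spikes x f pc bounds k-lengths)
    where
    contradict : (∃[ A ] NonZero A × InfinitelyMany (SpikeAt x A 0ℚ (fromℕ A))) → ⊥
    contradict (A , A≢0 , often) = Bisection.discontinuous x f pc A {{A≢0}} often continuous

theorem2 : (em : ExcludedMiddle 0ℓ) → let open Classical em in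
    (f : ℝ≥0 → ℝ≥0) → Continuous f → NonDecreasing f →
    (x : ℕ → ℝ) → (∀ i → 0ℝ ≤ x i × x i < 1ℝ) →
    (∃[ k ] InfinitelyMany (λ N → distinctGapLengths x N ℕ.≤ k)) →
    ¬ HasPairCorrelations f x
theorem2 em f continuous _ = no-pair-correlations f continuous
  where open PairCorrelations em using (no-pair-correlations)
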